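{- Every weak factorization structure is a factorization structure.
   Context: Let $\mathbb{F}=\mathbb{R}$ or $\mathbb{C}$, $V_1,\ldots,V_m$ ($m\ge2$) 2-dimensional $\mathbb{F}$-vector spaces, $V^*=V_1^*\otimes\cdots\otimes V_m^*$. For $\ell\in\mathbb{P}(V_j)$ (the set of 1-dimensional subspaces, with Zariski topology) let $\Sigma^0_{j,\ell}=V_1^*\otimes\cdots\otimes V_{j-1}^*\otimes\ell^0\otimes V_{j+1}^*\otimes\cdots\otimes V_m^*$, where $\ell^0\subset V_j^*$ is the annihilator of $\ell$. "Generic $\ell$" means all $\ell$ in some nonempty Zariski-open subset. A weak factorization structure of dimension $m$ is an injective linear map $\varphi:\mathfrak{h}\to V^*$ with $\dim\mathfrak{h}=m+1$ such that $\dim(\varphi(\mathfrak{h})\cap\Sigma^0_{j,\ell})\ge1$ for every $j$ and generic $\ell\in\mathbb{P}(V_j)$. A factorization structure is such a map with $\dim(\varphi(\mathfrak{h})\cap\Sigma^0_{j,\ell})=1$ for every $j$ and generic $\ell\in\mathbb{P}(V_j)$. -}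

module Defs where

open import Algebra.Bundles using (CommutativeRing)
open import Algebra.Module.Bundles using (LeftModule)
open import Algebra.Module.Construct.TensorUnit using (leftModule)
open import Algebra.Module.Morphism.Structures using (module LeftModuleMorphisms)
import Algebra.Properties.AbelianGroup as AbelianGroupProperties
import Algebra.Properties.CommutativeMonoid.Sum as Sum
import Algebra.Properties.CommutativeSemigroup as CommutativeSemigroupProperties
import Algebra.Properties.Ring as RingProperties
open import Data.Fin.Base using (Fin)
open import Data.Nat.Base as ℕ using (ℕ)
open import Data.Product using (∃; Σ-syntax; _×_; _,_)
open import Data.Product.Relation.Binary.Pointwise.NonDependent using (×-isEquivalence)
open import Data.Unit.Base using (tt)
open import Function.Bundles using (_⇔_)
open import Level using (0ℓ)
open import Relation.Binary.Core using (Rel)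
open import Relation.Binary.PropositionalEquality.Core using (_≢_)
open import Relation.Binary.Structures using (IsEquivalence; IsTotalOrder)
import Relation.Binary.Reasoning.Setoid as SetoidReasoning
open import Relation.Nullary.Negation using (¬_)
open import Relation.Unary using (Pred; Satisfiable; U; ∁)

-- The standard library has no real numbers.  Classically, the field of real
-- numbers is the complete ordered field, unique up to unique isomorphism, and
-- ℝ is used below through this characterisation.
record CompleteOrderedField : Set₁ where
  infix 4 _≤_
  field
    commutativeRing : CommutativeRing 0ℓ 0ℓ

  open CommutativeRing commutativeRing public

  field
    _≤_          : Rel Carrier 0ℓ
    isTotalOrder : IsTotalOrder _≈_ _≤_
    0≉1          : ¬ (0# ≈ 1#)
    inverse      : ∀ x → ¬ (x ≈ 0#) → ∃ λ y → x * y ≈ 1#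
    +-mono-≤     : ∀ {x y} z → x ≤ y → x + z ≤ y + z
    *-nonNeg     : ∀ {x y} → 0# ≤ x → 0# ≤ y → 0# ≤ x * y

  IsUpperBound : Pred Carrier 0ℓ → Carrier → Set
  IsUpperBound P b = ∀ x → P x → x ≤ b

  field
    supremum : (P : Pred Carrier 0ℓ) → Satisfiable P → ∃ (IsUpperBound P) →
               Σ[ s ∈ Carrier ] IsUpperBound P s × (∀ b → IsUpperBound P b → s ≤ b)

-- (a , b) stands for a + b i.
module Complex (ℝ : CompleteOrderedField) where
  open CompleteOrderedField ℝ
  open CommutativeSemigroupProperties
    (CommutativeRing.+-commutativeSemigroup commutativeRing) using (interchange)
  open AbelianGroupProperties +-abelianGroup using (⁻¹-∙-comm; ε⁻¹≈ε)
  open RingProperties ring using (-‿distribˡ-*; -‿distribʳ-*)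
  open SetoidReasoning setoid

  private
    ℂ : Set
    ℂ = Carrier × Carrier

    _≈ᶜ_ : Rel ℂ 0ℓ
    (a , b) ≈ᶜ (c , d) = a ≈ c × b ≈ d

    _+ᶜ_ _*ᶜ_ : ℂ → ℂ → ℂ
    (a , b) +ᶜ (c , d) = a + c , b + d
    (a , b) *ᶜ (c , d) = a * c - b * d , a * d + b * c

    -ᶜ_ : ℂ → ℂ
    -ᶜ (a , b) = - a , - b

    sub-cong : ∀ {a b c d} → a ≈ b → c ≈ d → a - c ≈ b - d
    sub-cong p q = +-cong p (-‿cong q)

    sub-interchange : ∀ a b c d → (a + b) - (c + d) ≈ (a - c) + (b - d)
    sub-interchange a b c d = begin
      (a + b) - (c + d)       ≈⟨ +-congˡ (⁻¹-∙-comm c d) ⟨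
      (a + b) + (- c - d)     ≈⟨ interchange a b (- c) (- d) ⟩
      (a - c) + (b - d)       ∎

    distribˡ-sub : ∀ x y z → x * (y - z) ≈ x * y - x * z
    distribˡ-sub x y z = trans (distribˡ x y (- z)) (+-congˡ (sym (-‿distribʳ-* x z)))

    distribʳ-sub : ∀ x y z → (y - z) * x ≈ y * x - z * x
    distribʳ-sub x y z = trans (distribʳ x y (- z)) (+-congˡ (sym (-‿distribˡ-* z x)))

    assocᶜ : ∀ x y z → ((x *ᶜ y) *ᶜ z) ≈ᶜ (x *ᶜ (y *ᶜ z))
    assocᶜ (a , b) (c , d) (e , f) = re , im
      where
      re : (a * c - b * d) * e - (a * d + b * c) * f
           ≈ a * (c * e - d * f) - b * (c * f + d * e)
      re = begin
        (a * c - b * d) * e - (a * d + b * c) * f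
          ≈⟨ sub-cong (distribʳ-sub e _ _) (distribʳ f _ _) ⟩
        ((a * c) * e - (b * d) * e) - ((a * d) * f + (b * c) * f)
          ≈⟨ sub-cong (sub-cong (*-assoc _ _ _) (*-assoc _ _ _))
                      (+-cong (*-assoc _ _ _) (*-assoc _ _ _)) ⟩
        (a * (c * e) - b * (d * e)) - (a * (d * f) + b * (c * f))
          ≈⟨ sub-interchange _ _ _ _ ⟩
        (a * (c * e) - a * (d * f)) + (- (b * (d * e)) - b * (c * f))
          ≈⟨ +-congˡ (trans (⁻¹-∙-comm _ _) (-‿cong (+-comm _ _))) ⟩
        (a * (c * e) - a * (d * f)) - (b * (c * f) + b * (d * e))
          ≈⟨ sub-cong (distribˡ-sub a _ _) (distribˡ b _ _) ⟨
        a * (c * e - d * f) - b * (c * f + d * e) ∎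

      im : (a * c - b * d) * f + (a * d + b * c) * e
           ≈ a * (c * f + d * e) + b * (c * e - d * f)
      im = begin
        (a * c - b * d) * f + (a * d + b * c) * e
          ≈⟨ +-cong (distribʳ-sub f _ _) (distribʳ e _ _) ⟩
        ((a * c) * f - (b * d) * f) + ((a * d) * e + (b * c) * e)
          ≈⟨ +-cong (sub-cong (*-assoc _ _ _) (*-assoc _ _ _))
                    (+-cong (*-assoc _ _ _) (*-assoc _ _ _)) ⟩
        (a * (c * f) - b * (d * f)) + (a * (d * e) + b * (c * e))
          ≈⟨ interchange _ _ _ _ ⟩
        (a * (c * f) + a * (d * e)) + (- (b * (d * f)) + b * (c * e))
          ≈⟨ +-congˡ (+-comm _ _) ⟩
        (a * (c * f) + a * (d * e)) + (b * (c * e) - b * (d * f))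
          ≈⟨ +-cong (distribˡ a _ _) (distribˡ-sub b _ _) ⟨
        a * (c * f + d * e) + b * (c * e - d * f) ∎

    commᶜ : ∀ x y → (x *ᶜ y) ≈ᶜ (y *ᶜ x)
    commᶜ (a , b) (c , d) =
      sub-cong (*-comm a c) (*-comm b d) ,
      trans (+-comm _ _) (+-cong (*-comm b c) (*-comm a d))

    identityˡᶜ : ∀ x → ((1# , 0#) *ᶜ x) ≈ᶜ x
    identityˡᶜ (a , b) =
      trans (sub-cong (*-identityˡ a) (zeroˡ b)) (trans (+-congˡ ε⁻¹≈ε) (+-identityʳ a)) ,
      trans (+-cong (*-identityˡ b) (zeroˡ a)) (+-identityʳ b)

    distribˡᶜ : ∀ x y z → (x *ᶜ (y +ᶜ z)) ≈ᶜ ((x *ᶜ y) +ᶜ (x *ᶜ z))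
    distribˡᶜ (a , b) (c , d) (e , f) =
      trans (sub-cong (distribˡ a c e) (distribˡ b d f)) (sub-interchange _ _ _ _) ,
      trans (+-cong (distribˡ a d f) (distribˡ b c e)) (interchange _ _ _ _)

    ≈ᶜ-isEquivalence : IsEquivalence _≈ᶜ_
    ≈ᶜ-isEquivalence = ×-isEquivalence isEquivalence isEquivalence

    +ᶜ-cong : ∀ {x y u v} → x ≈ᶜ y → u ≈ᶜ v → (x +ᶜ u) ≈ᶜ (y +ᶜ v)
    +ᶜ-cong (p , q) (r , s) = +-cong p r , +-cong q s

    *ᶜ-cong : ∀ {x y u v} → x ≈ᶜ y → u ≈ᶜ v → (x *ᶜ u) ≈ᶜ (y *ᶜ v)
    *ᶜ-cong (p , q) (r , s) =
      sub-cong (*-cong p r) (*-cong q s) , +-cong (*-cong p s) (*-cong q r)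

  complexRing : CommutativeRing 0ℓ 0ℓ
  complexRing = record
    { Carrier = ℂ
    ; _≈_ = _≈ᶜ_
    ; _+_ = _+ᶜ_
    ; _*_ = _*ᶜ_
    ; -_ = -ᶜ_
    ; 0# = 0# , 0#
    ; 1# = 1# , 0#
    ; isCommutativeRing = record
      { isRing = record
        { +-isAbelianGroup = record
          { isGroup = record
            { isMonoid = record
              { isSemigroup = record
                { isMagma = record
                  { isEquivalence = ≈ᶜ-isEquivalence
                  ; ∙-cong = +ᶜ-cong
                  }
                ; assoc = λ (a , b) (c , d) (e , f) → +-assoc a c e , +-assoc b d f
                }
              ; identity = (λ (a , b) → +-identityˡ a , +-identityˡ b)
                         , (λ (a , b) → +-identityʳ a , +-identityʳ b)
              }
            ; inverse = (λ (a , b) → -‿inverseˡ a , -‿inverseˡ b)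
                      , (λ (a , b) → -‿inverseʳ a , -‿inverseʳ b)
            ; ⁻¹-cong = λ (p , q) → -‿cong p , -‿cong q
            }
          ; comm = λ (a , b) (c , d) → +-comm a c , +-comm b d
          }
        ; *-cong = *ᶜ-cong
        ; *-assoc = assocᶜ
        ; *-identity = identityˡᶜ
                     , (λ x → transᶜ (commᶜ x (1# , 0#)) (identityˡᶜ x))
        ; distrib = distribˡᶜ
                  , (λ x y z → transᶜ (commᶜ (y +ᶜ z) x)
                      (transᶜ (distribˡᶜ x y z) (+ᶜ-cong (commᶜ x y) (commᶜ x z))))
        }
      ; *-comm = commᶜ
      }
    }
    where open IsEquivalence ≈ᶜ-isEquivalence using () renaming (trans to transᶜ)

data ScalarField : Set where
  real complex : ScalarField

scalars : CompleteOrderedField → ScalarField → CommutativeRing 0ℓ 0ℓ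
scalars ℝ real    = CompleteOrderedField.commutativeRing ℝ
scalars ℝ complex = Complex.complexRing ℝ

-- The definitions below make sense over any commutative ring, but they express
-- the intended notions only when K is a field.
module Linear (K : CommutativeRing 0ℓ 0ℓ) where
  open CommutativeRing K

  VectorSpace : Set₁
  VectorSpace = LeftModule ring 0ℓ 0ℓ

  record Subspace (V : VectorSpace) : Set₁ where
    open LeftModule V
    field
      Member    : Pred Carrierᴹ 0ℓ
      ≈ᴹ-closed : ∀ {v w} → v ≈ᴹ w → Member v → Member w
      0ᴹ-closed : Member 0ᴹ
      +ᴹ-closed : ∀ {v w} → Member v → Member w → Member (v +ᴹ w)
      *ₗ-closed : ∀ c {v} → Member v → Member (c *ₗ v)

  open Subspace public using (Member)

  module _ (V : VectorSpace) where
    open LeftModule V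

    open Sum +ᴹ-commutativeMonoid using (sum)

    linearCombination : ∀ {n} → (Fin n → Carrier) → (Fin n → Carrierᴹ) → Carrierᴹ
    linearCombination c b = sum λ i → c i *ₗ b i

    record IsBasis (S : Pred Carrierᴹ 0ℓ) {n : ℕ} (b : Fin n → Carrierᴹ) : Set where
      field
        member      : ∀ i → S (b i)
        independent : ∀ c → linearCombination c b ≈ᴹ 0ᴹ → ∀ i → c i ≈ 0#
        spanning    : ∀ v → S v → ∃ λ c → v ≈ᴹ linearCombination c b

    whole : Subspace V
    whole = record
      { Member    = U
      ; ≈ᴹ-closed = λ _ _ → tt
      ; 0ᴹ-closed = tt
      ; +ᴹ-closed = λ _ _ → tt
      ; *ₗ-closed = λ _ _ → tt
      }

    data Span (S : Pred Carrierᴹ 0ℓ) : Pred Carrierᴹ 0ℓ where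
      generator : ∀ {v} → S v → Span S v
      ≈ᴹ-closed : ∀ {v w} → v ≈ᴹ w → Span S v → Span S w
      0ᴹ-closed : Span S 0ᴹ
      +ᴹ-closed : ∀ {v w} → Span S v → Span S w → Span S (v +ᴹ w)
      *ₗ-closed : ∀ c {v} → Span S v → Span S (c *ₗ v)

    span : Pred Carrierᴹ 0ℓ → Subspace V
    span S = record
      { Member    = Span S
      ; ≈ᴹ-closed = ≈ᴹ-closed
      ; 0ᴹ-closed = 0ᴹ-closed
      ; +ᴹ-closed = +ᴹ-closed
      ; *ₗ-closed = *ₗ-closed
      }

  module _ {V : VectorSpace} where
    open LeftModule V

    dim_≡_ : Subspace V → ℕ → Set
    dim S ≡ n = Σ[ b ∈ (Fin n → Carrierᴹ) ] IsBasis V (Member S) b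

    dim_≥_ : Subspace V → ℕ → Set
    dim S ≥ n = Σ[ d ∈ ℕ ] n ℕ.≤ d × dim S ≡ d

    _∩_ : Subspace V → Subspace V → Subspace V
    S ∩ T = record
      { Member    = λ v → Member S v × Member T v
      ; ≈ᴹ-closed = λ e (p , q) → S.≈ᴹ-closed e p , T.≈ᴹ-closed e q
      ; 0ᴹ-closed = S.0ᴹ-closed , T.0ᴹ-closed
      ; +ᴹ-closed = λ (p , q) (r , s) → S.+ᴹ-closed p r , T.+ᴹ-closed q s
      ; *ₗ-closed = λ c (p , q) → S.*ₗ-closed c p , T.*ₗ-closed c q
      }
      where
      module S = Subspace S
      module T = Subspace T

  module _ (V W : VectorSpace) where
    open LeftModuleMorphisms (LeftModule.rawLeftModule V) (LeftModule.rawLeftModule W)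
    private
      module V = LeftModule V
      module W = LeftModule W

    IsLinear : (V.Carrierᴹ → W.Carrierᴹ) → Set
    IsLinear = IsLeftModuleHomomorphism

    IsInjectiveLinear : (V.Carrierᴹ → W.Carrierᴹ) → Set
    IsInjectiveLinear = IsLeftModuleMonomorphism

    image : ∀ {φ} → IsLinear φ → Subspace W
    image {φ} isLinear = record
      { Member    = λ w → ∃ λ v → φ v W.≈ᴹ w
      ; ≈ᴹ-closed = λ e (v , p) → v , W.≈ᴹ-trans p e
      ; 0ᴹ-closed = V.0ᴹ , 0ᴹ-homo
      ; +ᴹ-closed = λ (v , p) (v′ , p′) →
          v V.+ᴹ v′ , W.≈ᴹ-trans (+ᴹ-homo v v′) (W.+ᴹ-cong p p′)
      ; *ₗ-closed = λ c (v , p) →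
          c V.*ₗ v , W.≈ᴹ-trans (*ₗ-homo c v) (W.*ₗ-cong refl p)
      }
      where open IsLeftModuleHomomorphism isLinear

    linear : (f : V.Carrierᴹ → W.Carrierᴹ) →
             (∀ {v w} → v V.≈ᴹ w → f v W.≈ᴹ f w) →
             (∀ v w → f (v V.+ᴹ w) W.≈ᴹ f v W.+ᴹ f w) →
             (∀ c v → f (c V.*ₗ v) W.≈ᴹ c W.*ₗ f v) → IsLinear f
    linear f f-cong f-+ f-* = record
      { +ᴹ-isGroupHomomorphism = record
        { isMonoidHomomorphism = record
          { isMagmaHomomorphism = record
            { isRelHomomorphism = record { cong = f-cong }
            ; homo = f-+
            }
          ; ε-homo = f-0
          }
        ; ⁻¹-homo = λ v → inverseˡ-unique (f (V.-ᴹ v)) (f v)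
            (W.≈ᴹ-trans (W.≈ᴹ-sym (f-+ (V.-ᴹ v) v))
              (W.≈ᴹ-trans (f-cong (V.-ᴹ‿inverseˡ v)) f-0))
        }
      ; *ₗ-homo = f-*
      }
      where
      open AbelianGroupProperties W.+ᴹ-abelianGroup using (inverseˡ-unique)
      f-0 : f V.0ᴹ W.≈ᴹ W.0ᴹ
      f-0 = W.≈ᴹ-trans (f-cong (V.≈ᴹ-sym (V.*ₗ-zeroˡ V.0ᴹ)))
              (W.≈ᴹ-trans (f-* 0# V.0ᴹ) (W.*ₗ-zeroˡ (f V.0ᴹ)))

  module _ (V : VectorSpace) where
    private
      module V = LeftModule V
      module 𝟙 = LeftModule (leftModule {R = ring})

    record LinearForm : Set where
      field
        apply    : V.Carrierᴹ → Carrier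
        isLinear : IsLinear V (leftModule {R = ring}) apply

      open LeftModuleMorphisms.IsLeftModuleHomomorphism isLinear public

  open LinearForm public using (apply)

  module _ (V : VectorSpace) where
    private
      module V = LeftModule V
      open CommutativeSemigroupProperties +-commutativeSemigroup using (interchange)
      open CommutativeSemigroupProperties *-commutativeSemigroup using (x∙yz≈y∙xz)
      open AbelianGroupProperties +-abelianGroup using (⁻¹-∙-comm)
      open RingProperties ring using (-‿distribʳ-*)

      form : (f : V.Carrierᴹ → Carrier) →
             (∀ {v w} → v V.≈ᴹ w → f v ≈ f w) →
             (∀ v w → f (v V.+ᴹ w) ≈ f v + f w) →
             (∀ c v → f (c V.*ₗ v) ≈ c * f v) → LinearForm V
      form f p q r = record { apply = f ; isLinear = linear V leftModule f p q r }

      _+ᶠ_ : LinearForm V → LinearForm V → LinearForm V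
      α +ᶠ β = form (λ v → apply α v + apply β v)
        (λ e → +-cong (α.⟦⟧-cong e) (β.⟦⟧-cong e))
        (λ v w → trans (+-cong (α.+ᴹ-homo v w) (β.+ᴹ-homo v w)) (interchange _ _ _ _))
        (λ c v → trans (+-cong (α.*ₗ-homo c v) (β.*ₗ-homo c v)) (sym (distribˡ c _ _)))
        where
        module α = LinearForm α
        module β = LinearForm β

      0ᶠ : LinearForm V
      0ᶠ = form (λ _ → 0#) (λ _ → refl) (λ _ _ → sym (+-identityˡ 0#)) (λ c _ → sym (zeroʳ c))

      -ᶠ_ : LinearForm V → LinearForm V
      -ᶠ α = form (λ v → - apply α v)
        (λ e → -‿cong (α.⟦⟧-cong e))
        (λ v w → trans (-‿cong (α.+ᴹ-homo v w)) (sym (⁻¹-∙-comm _ _)))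
        (λ c v → trans (-‿cong (α.*ₗ-homo c v)) (-‿distribʳ-* c _))
        where module α = LinearForm α

      _·ᶠ_ : Carrier → LinearForm V → LinearForm V
      a ·ᶠ α = form (λ v → a * apply α v)
        (λ e → *-congˡ (α.⟦⟧-cong e))
        (λ v w → trans (*-congˡ (α.+ᴹ-homo v w)) (distribˡ a _ _))
        (λ c v → trans (*-congˡ (α.*ₗ-homo c v)) (x∙yz≈y∙xz a c _))
        where module α = LinearForm α

    Dual : VectorSpace
    Dual = record
      { Carrierᴹ = LinearForm V
      ; _≈ᴹ_ = λ α β → ∀ v → apply α v ≈ apply β v
      ; _+ᴹ_ = _+ᶠ_
      ; _*ₗ_ = _·ᶠ_
      ; 0ᴹ = 0ᶠ
      ; -ᴹ_ = -ᶠ_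
      ; isLeftModule = record
        { isLeftSemimodule = record
          { +ᴹ-isCommutativeMonoid = record
            { isMonoid = record
              { isSemigroup = record
                { isMagma = record
                  { isEquivalence = record
                    { refl = λ _ → refl
                    ; sym = λ p v → sym (p v)
                    ; trans = λ p q v → trans (p v) (q v)
                    }
                  ; ∙-cong = λ p q v → +-cong (p v) (q v)
                  }
                ; assoc = λ _ _ _ _ → +-assoc _ _ _
                }
              ; identity = (λ _ _ → +-identityˡ _) , (λ _ _ → +-identityʳ _)
              }
            ; comm = λ _ _ _ → +-comm _ _
            }
          ; isPreleftSemimodule = record
            { *ₗ-cong = λ p q v → *-cong p (q v)
            ; *ₗ-zeroˡ = λ _ _ → zeroˡ _
            ; *ₗ-distribʳ = λ _ _ _ _ → distribʳ _ _ _
            ; *ₗ-identityˡ = λ _ _ → *-identityˡ _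
            ; *ₗ-assoc = λ _ _ _ _ → *-assoc _ _ _
            ; *ₗ-zeroʳ = λ _ _ → zeroʳ _
            ; *ₗ-distribˡ = λ _ _ _ _ → distribˡ _ _ _
            }
          }
        ; -ᴹ‿cong = λ p v → -‿cong (p v)
        ; -ᴹ‿inverse = (λ _ _ → -‿inverseˡ _) , (λ _ _ → -‿inverseʳ _)
        }
      }

    annihilator : Subspace V → Subspace Dual
    annihilator S = record
      { Member    = λ α → ∀ v → Member S v → apply α v ≈ 0#
      ; ≈ᴹ-closed = λ e p v s → trans (sym (e v)) (p v s)
      ; 0ᴹ-closed = λ _ _ → refl
      ; +ᴹ-closed = λ p q v s → trans (+-cong (p v s) (q v s)) (+-identityˡ 0#)
      ; *ₗ-closed = λ c p v s → trans (*-congˡ (p v s)) (zeroʳ c)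
      }

  -- The tensor product of W 0 , … , W (m-1): formal linear combinations of
  -- pure tensors, modulo the smallest congruence containing the vector space
  -- axioms and multilinearity.
  module _ {m : ℕ} (W : Fin m → VectorSpace) where
    private module W i = LeftModule (W i)

    data Tensor : Set where
      pure : (∀ i → W.Carrierᴹ i) → Tensor
      _⊕_  : Tensor → Tensor → Tensor
      _⊙_  : Carrier → Tensor → Tensor
      𝟎    : Tensor
      ⊖_   : Tensor → Tensor

    infix 4 _≋_
    data _≋_ : Rel Tensor 0ℓ where
      ≋-refl  : ∀ {t} → t ≋ t
      ≋-sym   : ∀ {s t} → s ≋ t → t ≋ s
      ≋-trans : ∀ {s t u} → s ≋ t → t ≋ u → s ≋ u

      pure-cong : ∀ {u v} → (∀ i → W._≈ᴹ_ i (u i) (v i)) → pure u ≋ pure v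
      ⊕-cong    : ∀ {s s′ t t′} → s ≋ s′ → t ≋ t′ → (s ⊕ t) ≋ (s′ ⊕ t′)
      ⊙-cong    : ∀ {c c′ t t′} → c ≈ c′ → t ≋ t′ → (c ⊙ t) ≋ (c′ ⊙ t′)
      ⊖-cong    : ∀ {t t′} → t ≋ t′ → (⊖ t) ≋ (⊖ t′)

      ⊕-assoc     : ∀ s t u → ((s ⊕ t) ⊕ u) ≋ (s ⊕ (t ⊕ u))
      ⊕-comm      : ∀ s t → (s ⊕ t) ≋ (t ⊕ s)
      ⊕-identityˡ : ∀ t → (𝟎 ⊕ t) ≋ t
      ⊖-inverseˡ  : ∀ t → ((⊖ t) ⊕ t) ≋ 𝟎
      ⊙-distribˡ  : ∀ c s t → (c ⊙ (s ⊕ t)) ≋ ((c ⊙ s) ⊕ (c ⊙ t))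
      ⊙-distribʳ  : ∀ t c d → ((c + d) ⊙ t) ≋ ((c ⊙ t) ⊕ (d ⊙ t))
      ⊙-assoc     : ∀ c d t → ((c * d) ⊙ t) ≋ (c ⊙ (d ⊙ t))
      ⊙-identityˡ : ∀ t → (1# ⊙ t) ≋ t
      ⊙-zeroˡ     : ∀ t → (0# ⊙ t) ≋ 𝟎
      ⊙-zeroʳ     : ∀ c → (c ⊙ 𝟎) ≋ 𝟎

      -- u, v, w agree away from the factor j, and u j = v j + w j.
      pure-+ : ∀ j {u v w} →
               (∀ i → i ≢ j → W._≈ᴹ_ i (u i) (v i)) →
               (∀ i → i ≢ j → W._≈ᴹ_ i (u i) (w i)) →
               W._≈ᴹ_ j (u j) (W._+ᴹ_ j (v j) (w j)) →
               pure u ≋ (pure v ⊕ pure w)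
      pure-* : ∀ j c {u v} →
               (∀ i → i ≢ j → W._≈ᴹ_ i (u i) (v i)) →
               W._≈ᴹ_ j (u j) (W._*ₗ_ j c (v j)) →
               pure u ≋ (c ⊙ pure v)

    ⨂ : VectorSpace
    ⨂ = record
      { Carrierᴹ = Tensor
      ; _≈ᴹ_ = _≋_
      ; _+ᴹ_ = _⊕_
      ; _*ₗ_ = _⊙_
      ; 0ᴹ = 𝟎
      ; -ᴹ_ = ⊖_
      ; isLeftModule = record
        { isLeftSemimodule = record
          { +ᴹ-isCommutativeMonoid = record
            { isMonoid = record
              { isSemigroup = record
                { isMagma = record
                  { isEquivalence = record
                    { refl = ≋-refl ; sym = ≋-sym ; trans = ≋-trans }
                  ; ∙-cong = ⊕-cong
                  }
                ; assoc = ⊕-assoc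
                }
              ; identity = ⊕-identityˡ , (λ t → ≋-trans (⊕-comm t 𝟎) (⊕-identityˡ t))
              }
            ; comm = ⊕-comm
            }
          ; isPreleftSemimodule = record
            { *ₗ-cong = ⊙-cong
            ; *ₗ-zeroˡ = ⊙-zeroˡ
            ; *ₗ-distribʳ = ⊙-distribʳ
            ; *ₗ-identityˡ = ⊙-identityˡ
            ; *ₗ-assoc = ⊙-assoc
            ; *ₗ-zeroʳ = ⊙-zeroʳ
            ; *ₗ-distribˡ = ⊙-distribˡ
            }
          }
        ; -ᴹ‿cong = ⊖-cong
        ; -ᴹ‿inverse = ⊖-inverseˡ
                     , (λ t → ≋-trans (⊕-comm t (⊖ t)) (⊖-inverseˡ t))
        }
      }

  module _ (V : VectorSpace) where
    open LeftModule V using (Carrierᴹ)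

    -- The points of ℙ(V).
    record ℙ : Set₁ where
      field
        line  : Subspace V
        dim-1 : dim line ≡ 1

    open ℙ public using (line)

    -- Homogeneous polynomials of degree d on V, without choosing coordinates:
    -- generated by constants and linear forms.
    data Homogeneous : ℕ → Set where
      constant : Carrier → Homogeneous 0
      form     : LinearForm V → Homogeneous 1
      _⊞_      : ∀ {d} → Homogeneous d → Homogeneous d → Homogeneous d
      _⊠_      : ∀ {d e} → Homogeneous d → Homogeneous e → Homogeneous (d ℕ.+ e)

    evaluate : ∀ {d} → Homogeneous d → Carrierᴹ → Carrier
    evaluate (constant c) v = c
    evaluate (form α)     v = apply α v
    evaluate (p ⊞ q)      v = evaluate p v + evaluate q v
    evaluate (p ⊠ q)      v = evaluate p v * evaluate q v

    VanishesOn : ∀ {d} → Homogeneous d → ℙ → Set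
    VanishesOn p ℓ = ∀ v → Member (line ℓ) v → evaluate p v ≈ 0#

    -- Common zero loci of families of homogeneous polynomials.
    IsZariskiClosed : Pred ℙ 0ℓ → Set₁
    IsZariskiClosed Z =
      Σ[ I ∈ Set ] Σ[ d ∈ (I → ℕ) ] Σ[ f ∈ (∀ i → Homogeneous (d i)) ]
        (∀ ℓ → Z ℓ ⇔ (∀ i → VanishesOn (f i) ℓ))

    IsZariskiOpen : Pred ℙ 0ℓ → Set₁
    IsZariskiOpen O = IsZariskiClosed (∁ O)

    ForGeneric : Pred ℙ 0ℓ → Set₁
    ForGeneric P = Σ[ O ∈ Pred ℙ 0ℓ ] IsZariskiOpen O × Satisfiable O × (∀ ℓ → O ℓ → P ℓ)

  module _ {m : ℕ} (V : Fin m → VectorSpace) where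
    V* : VectorSpace
    V* = ⨂ (λ i → Dual (V i))

    -- V₁* ⊗ … ⊗ ℓ⁰ ⊗ … ⊗ V_m* as a subspace of V*, that is, the image of the
    -- (injective) map induced by the inclusion of ℓ⁰ in V_j*.
    Σ⁰ : (j : Fin m) → ℙ (V j) → Subspace V*
    Σ⁰ j ℓ = span V* λ t →
      ∃ λ α → Member (annihilator (V j) (line ℓ)) (α j) × pure α ≋V* t
      where
      open LeftModule V* using () renaming (_≈ᴹ_ to _≋V*_)

    module _ (𝔥 : VectorSpace)
             (φ : LeftModule.Carrierᴹ 𝔥 → LeftModule.Carrierᴹ V*) where
      open LeftModuleMorphisms.IsLeftModuleMonomorphism using (isLeftModuleHomomorphism)

      record IsWeakFactorizationStructure : Set₁ where
        field
          isInjectiveLinear : IsInjectiveLinear 𝔥 V* φ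
          dim-𝔥             : dim whole 𝔥 ≡ (m ℕ.+ 1)

        φ⟨𝔥⟩ : Subspace V*
        φ⟨𝔥⟩ = image 𝔥 V* (isLeftModuleHomomorphism isInjectiveLinear)

        field
          generic : ∀ j → ForGeneric (V j) λ ℓ → dim (φ⟨𝔥⟩ ∩ Σ⁰ j ℓ) ≥ 1

      record IsFactorizationStructure : Set₁ where
        field
          isInjectiveLinear : IsInjectiveLinear 𝔥 V* φ
          dim-𝔥             : dim whole 𝔥 ≡ (m ℕ.+ 1)

        φ⟨𝔥⟩ : Subspace V*
        φ⟨𝔥⟩ = image 𝔥 V* (isLeftModuleHomomorphism isInjectiveLinear)

        field
          generic : ∀ j → ForGeneric (V j) λ ℓ → dim (φ⟨𝔥⟩ ∩ Σ⁰ j ℓ) ≡ 1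

{-# OPTIONS --safe #-}

-- Evaluate the tensors φ(z) at tuples of vectors: φ(z) lies in Σ⁰ for j and ℓ = [v] only
-- if it vanishes when v is put into the slot j.  Call the family degenerate at j if every v
-- admits a z with φ(z) ≠ 0 that is annihilated in this way.
--
-- * Degeneracy at infinitely many points of a line of vectors v implies degeneracy at all
--   its points, so a weak factorization structure is degenerate at every j.
-- * Putting a generic v into the slot j preserves degeneracy at the other slots, and lowers
--   the rank of the family by the dimension of the space of the annihilated φ(z).
--
-- By induction, a family degenerate at k ≥ 1 slots has rank at least k + 1.  A weak
-- factorization structure has rank m + 1; if the intersection with Σ⁰ were of dimension at
-- least 2 for a generic v, then putting v into the slot j would leave a family of rank at most
-- m − 1 that is degenerate at the other m − 1 slots.
module Submission where

open import Defs
open import Algebra.Bundles using (CommutativeRing; CommutativeMonoid)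
open import Algebra.Module.Bundles using (LeftModule)
open import Algebra.Module.Construct.TensorUnit using (leftModule)
open import Algebra.Module.Morphism.Structures using (module LeftModuleMorphisms)
import Algebra.Properties.AbelianGroup as AbelianGroupProperties
import Algebra.Properties.CommutativeMonoid.Sum as Sum
import Algebra.Properties.CommutativeSemigroup as CommutativeSemigroupProperties
import Algebra.Properties.Ring as RingProperties
import Algebra.Properties.Semiring.Mult as Mult
import Algebra.Solver.Ring as RingSolver
open import Algebra.Solver.Ring.AlmostCommutativeRing
  using (_-Raw-AlmostCommutative⟶_; fromCommutativeRing)
open import Axiom.ExcludedMiddle using (ExcludedMiddle)
open import Data.Empty using (⊥)
open import Data.Fin.Base as Fin using (Fin; zero; suc)
import Data.Fin.Properties as Finₚ
open import Data.Integer.Base as ℤ using (ℤ; +_; -[1+_])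
import Data.Integer.Properties as ℤₚ
open import Data.List.Base using (List; []; _∷_; length; map; allFin)
open import Data.List.Membership.Propositional.Properties using (∈-allFin)
open import Data.List.Properties using (length-map; length-tabulate)
open import Data.List.Relation.Unary.All as All using (All; []; _∷_)
import Data.List.Relation.Unary.All.Properties as Allₚ
open import Data.List.Relation.Unary.AllPairs using ([]; _∷_)
open import Data.List.Relation.Unary.Unique.Propositional using (Unique)
open import Data.List.Relation.Unary.Unique.Propositional.Properties using (allFin⁺; map⁺)
open import Data.Maybe.Base using (Maybe; just; nothing)
open import Data.Nat.Base as ℕ using (ℕ; zero; suc; _≤_; z≤n; s≤s; _≤′_; ≤′-refl; ≤′-step)
import Data.Nat.Properties as ℕₚ
open import Data.Product using (∃; Σ-syntax; _×_; _,_; proj₁; proj₂)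
open import Data.Sum.Base using (inj₁; inj₂)
open import Data.Unit.Base using (⊤)
open import Data.Vec.Functional using (insertAt; removeAt)
open import Data.Vec.Functional.Properties using (insertAt-lookup; insertAt-punchIn)
open import Function.Base using (_∘_; id)
open import Function.Bundles using (Equivalence; mk⇔)
open import Level using (0ℓ)
open import Relation.Binary.Definitions using (tri<; tri≈; tri>)
open import Relation.Binary.PropositionalEquality as ≡ using (_≡_; _≢_)
import Relation.Binary.Reasoning.Setoid as SetoidReasoning
open import Relation.Binary.Structures using (IsTotalOrder)
open import Relation.Nullary.Decidable using (Dec; yes; no; decidable-stable)
open import Relation.Nullary.Negation using (¬_; contradiction)
open import Relation.Unary using (Pred)

-- Along a line u + t d of vectors in one slot the family is a pencil α + t β. Degeneracy at
-- infinitely many parameters gives elements killed at distinct parameters s i, more of them than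
-- the rank; so they are dependent modulo the kernel, and dividing the terms of a relation by t - s
-- i produces, possibly after shortening the relation, an element killed at any other t.
--
-- Putting u into the slot j can destroy degeneracy at another slot only for u on a single line of V
-- j. This is where dimension 2 enters: a z killed by T(u, ·) and T(v, ·) for independent u and v is
-- killed by T. So the bad vectors lie in the zero set of a linear form, and a product of such forms
-- treats all slots at once.
--
-- The bound k + 1 instead of k is what yields the contradiction, as (m + 1) - 2 falls short of (m -
-- 1) + 1 by one only. It comes from the case k = 1: in rank 1 every plugged family would vanish,
-- hence the family itself.
--
-- The space of parameters z never changes. Plugging only enlarges the kernel, whose codimension is
-- the rank.

-- Ring solver over K with coefficients in ℤ, where equality is decidable

module IntegerCoefficients (K : CommutativeRing 0ℓ 0ℓ) where
  open CommutativeRing K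
  open Mult semiring using (×-homo-+; ×1-homo-*) renaming (_×_ to _·_)
  open AbelianGroupProperties +-abelianGroup using (⁻¹-∙-comm; ε⁻¹≈ε; ⁻¹-involutive)
  open CommutativeSemigroupProperties +-commutativeSemigroup using (interchange)
  open RingProperties ring using (-‿distribˡ-*; -‿distribʳ-*)
  open SetoidReasoning setoid

  fromℤ : ℤ → Carrier
  fromℤ (+ n)    = n · 1#
  fromℤ -[1+ n ] = - (suc n · 1#)

  fromℤ-⊖ : ∀ m n → fromℤ (m ℤ.⊖ n) ≈ m · 1# - n · 1#
  fromℤ-⊖ m       zero    = trans (sym (+-identityʳ _)) (+-congˡ (sym ε⁻¹≈ε))
  fromℤ-⊖ zero    (suc n) = sym (+-identityˡ _)
  fromℤ-⊖ (suc m) (suc n) = begin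
    fromℤ (suc m ℤ.⊖ suc n)                ≡⟨ ≡.cong fromℤ (ℤₚ.[1+m]⊖[1+n]≡m⊖n m n) ⟩
    fromℤ (m ℤ.⊖ n)                        ≈⟨ fromℤ-⊖ m n ⟩
    m · 1# - n · 1#                        ≈⟨ +-identityˡ _ ⟨
    0# + (m · 1# - n · 1#)                 ≈⟨ +-congʳ (-‿inverseʳ 1#) ⟨
    (1# - 1#) + (m · 1# - n · 1#)          ≈⟨ interchange _ _ _ _ ⟩
    (1# + m · 1#) + (- 1# - n · 1#)        ≈⟨ +-congˡ (⁻¹-∙-comm _ _) ⟩
    suc m · 1# - suc n · 1#                ∎

  fromℤ-neg : ∀ i → fromℤ (ℤ.- i) ≈ - fromℤ i
  fromℤ-neg (+ zero)  = sym ε⁻¹≈ε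
  fromℤ-neg (+ suc n) = refl
  fromℤ-neg -[1+ n ]  = sym (⁻¹-involutive _)

  fromℤ-+ : ∀ i j → fromℤ (i ℤ.+ j) ≈ fromℤ i + fromℤ j
  fromℤ-+ (+ m)    (+ n)    = ×-homo-+ 1# m n
  fromℤ-+ (+ m)    -[1+ n ] = fromℤ-⊖ m (suc n)
  fromℤ-+ -[1+ m ] (+ n)    = trans (fromℤ-⊖ n (suc m)) (+-comm _ _)
  fromℤ-+ -[1+ m ] -[1+ n ] = begin
    - (suc (suc (m ℕ.+ n)) · 1#)      ≡⟨ ≡.cong (λ k → - (suc k · 1#)) (ℕₚ.+-suc m n) ⟨
    - ((suc m ℕ.+ suc n) · 1#)        ≈⟨ -‿cong (×-homo-+ 1# (suc m) (suc n)) ⟩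
    - (suc m · 1# + suc n · 1#)       ≈⟨ ⁻¹-∙-comm _ _ ⟨
    - (suc m · 1#) - suc n · 1#       ∎

  fromℤ-*+ : ∀ m j → fromℤ (+ m ℤ.* j) ≈ m · 1# * fromℤ j
  fromℤ-*+ m (+ n)    = trans (reflexive (≡.cong fromℤ (≡.sym (ℤₚ.pos-* m n)))) (×1-homo-* m n)
  fromℤ-*+ m -[1+ n ] = begin
    fromℤ (+ m ℤ.* ℤ.- (+ suc n))     ≡⟨ ≡.cong fromℤ (ℤₚ.neg-distribʳ-* (+ m) (+ suc n)) ⟨
    fromℤ (ℤ.- (+ m ℤ.* + suc n))     ≈⟨ fromℤ-neg (+ m ℤ.* + suc n) ⟩
    - fromℤ (+ m ℤ.* + suc n)         ≈⟨ -‿cong (fromℤ-*+ m (+ suc n)) ⟩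
    - (m · 1# * suc n · 1#)           ≈⟨ -‿distribʳ-* _ _ ⟩
    m · 1# * - (suc n · 1#)           ∎

  fromℤ-* : ∀ i j → fromℤ (i ℤ.* j) ≈ fromℤ i * fromℤ j
  fromℤ-* (+ m)    j = fromℤ-*+ m j
  fromℤ-* -[1+ m ] j = begin
    fromℤ (ℤ.- (+ suc m) ℤ.* j)       ≡⟨ ≡.cong fromℤ (ℤₚ.neg-distribˡ-* (+ suc m) j) ⟨
    fromℤ (ℤ.- (+ suc m ℤ.* j))       ≈⟨ fromℤ-neg (+ suc m ℤ.* j) ⟩
    - fromℤ (+ suc m ℤ.* j)           ≈⟨ -‿cong (fromℤ-*+ (suc m) j) ⟩
    - (suc m · 1# * fromℤ j)          ≈⟨ -‿distribˡ-* _ _ ⟩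
    - (suc m · 1#) * fromℤ j          ∎

  private
    homomorphism : ℤ.+-*-rawRing -Raw-AlmostCommutative⟶ fromCommutativeRing K
    homomorphism = record
      { ⟦_⟧    = fromℤ
      ; +-homo = fromℤ-+
      ; *-homo = fromℤ-*
      ; -‿homo = fromℤ-neg
      ; 0-homo = refl
      -- `1 · 1#` unfolds to `1# + 0#`, and so does `con (+ 1)` in later solver calls; hence the
      -- uses of `+-identityʳ 1#` next to them.
      ; 1-homo = +-identityʳ 1#
      }

    ≈? : ∀ i j → Maybe (fromℤ i ≈ fromℤ j)
    ≈? i j with i ℤₚ.≟ j
    ... | yes i≡j = just (reflexive (≡.cong fromℤ i≡j))
    ... | no  _   = nothing

  open RingSolver ℤ.+-*-rawRing (fromCommutativeRing K) homomorphism ≈? public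
    using (solve; _:=_; _:+_; _:*_; _:-_; :-_; con)

-- Infinite fields and classical reasoning

-- The common ground of ℝ and ℂ for the proof. `ι` respects no structure: it is a supply of distinct
-- scalars, the parameters at which lines are sampled.
record InfiniteField : Set₁ where
  field
    commutativeRing : CommutativeRing 0ℓ 0ℓ

  open CommutativeRing commutativeRing public

  field
    0≉1         : ¬ (0# ≈ 1#)
    inverse     : ∀ x → ¬ (x ≈ 0#) → ∃ λ y → x * y ≈ 1#
    ι           : ℕ → Carrier
    ι-injective : ∀ {m n} → ι m ≈ ι n → m ≡ n

module OverInfiniteField (em : ExcludedMiddle 0ℓ) (K : InfiniteField) where
  open InfiniteField K hiding (zero)
  open IntegerCoefficients commutativeRing
  open Linear commutativeRing
  open AbelianGroupProperties +-abelianGroup using (x∙y⁻¹≈ε⇒x≈y)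

  dne : {P : Set} → ¬ ¬ P → P
  dne = decidable-stable em

  ¬∀⇒∃¬ : {A : Set} {P : A → Set} → ¬ (∀ a → P a) → ∃ λ a → ¬ P a
  ¬∀⇒∃¬ ¬∀ = dne λ ¬∃ → ¬∀ λ a → dne λ ¬p → ¬∃ (a , ¬p)

  *-nonzero : ∀ {x y} → x ≉ 0# → y ≉ 0# → x * y ≉ 0#
  *-nonzero {x} {y} x≉0 y≉0 xy≈0 with inverse x x≉0
  ... | x⁻¹ , xx⁻¹≈1 = y≉0 (begin
    y              ≈⟨ *-identityˡ y ⟨
    1# * y         ≈⟨ *-congʳ xx⁻¹≈1 ⟨
    (x * x⁻¹) * y  ≈⟨ solve 3 (λ a b c → (a :* b) :* c := b :* (a :* c)) refl x x⁻¹ y ⟩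
    x⁻¹ * (x * y)  ≈⟨ *-congˡ xy≈0 ⟩
    x⁻¹ * 0#       ≈⟨ zeroʳ x⁻¹ ⟩
    0#             ∎)
    where open SetoidReasoning setoid

  *-cancel-0 : ∀ {x y} → x ≉ 0# → x * y ≈ 0# → y ≈ 0#
  *-cancel-0 x≉0 xy≈0 = dne λ y≉0 → *-nonzero x≉0 y≉0 xy≈0

  -- Properties of the points with parameter `ι n` on a line. Two conditions that each fail for
  -- finitely many n hold together for some n, which is how general points are found.
  Eventually : (ℕ → Set) → Set
  Eventually P = ∃ λ N → ∀ n → N ≤ n → P n

  Frequently : (ℕ → Set) → Set
  Frequently P = ∀ N → ∃ λ n → N ≤ n × P n

  eventually-map : ∀ {P Q : ℕ → Set} → (∀ n → P n → Q n) → Eventually P → Eventually Q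
  eventually-map f (N , p) = N , λ n N≤n → f n (p n N≤n)

  eventually-∧ : ∀ {P Q : ℕ → Set} → Eventually P → Eventually Q → Eventually (λ n → P n × Q n)
  eventually-∧ (M , p) (N , q) = M ℕ.⊔ N , λ n M⊔N≤n →
    p n (ℕₚ.m⊔n≤o⇒m≤o M N M⊔N≤n) , q n (ℕₚ.m⊔n≤o⇒n≤o M N M⊔N≤n)

  eventually-inhabited : ∀ {P : ℕ → Set} → Eventually P → ∃ P
  eventually-inhabited (N , p) = N , p N ℕₚ.≤-refl

  eventually⇒frequently : ∀ {P : ℕ → Set} → Eventually P → Frequently P
  eventually⇒frequently (N , p) M =
    M ℕ.⊔ N , ℕₚ.m≤m⊔n M N , p (M ℕ.⊔ N) (ℕₚ.m≤n⊔m M N)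

  ¬frequently⇒eventually¬ : ∀ {P : ℕ → Set} → ¬ Frequently P → Eventually (λ n → ¬ P n)
  ¬frequently⇒eventually¬ ¬f with ¬∀⇒∃¬ ¬f
  ... | N , ¬∃ = N , λ n N≤n p → ¬∃ (n , N≤n , p)

  -- Each index is sought beyond the preceding one, which makes them distinct; hence the lower bound
  -- `N` in the recursion.
  frequently⇒increasing : ∀ {P : ℕ → Set} → Frequently P → ∀ k N →
    Σ[ f ∈ (Fin k → ℕ) ] (∀ i → N ≤ f i) × (∀ {i j} → f i ≡ f j → i ≡ j) × (∀ i → P (f i))
  frequently⇒increasing fr zero    N = (λ ()) , (λ ()) , (λ {i} → λ _ → contradiction i λ ()) , λ ()
  frequently⇒increasing {P} fr (suc k) N with fr N
  ... | n , N≤n , pn with frequently⇒increasing fr k (suc n)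
  ...   | f , n<f , f-inj , pf = g , N≤g , g-inj , pg
    where
    g : Fin (suc k) → ℕ
    g zero    = n
    g (suc i) = f i

    N≤g : ∀ i → N ≤ g i
    N≤g zero    = N≤n
    N≤g (suc i) = ℕₚ.≤-trans N≤n (ℕₚ.<⇒≤ (n<f i))

    g-inj : ∀ {i j} → g i ≡ g j → i ≡ j
    g-inj {zero}  {zero}  _  = ≡.refl
    g-inj {zero}  {suc j} eq = contradiction eq (ℕₚ.<⇒≢ (n<f j))
    g-inj {suc i} {zero}  eq = contradiction (≡.sym eq) (ℕₚ.<⇒≢ (n<f i))
    g-inj {suc i} {suc j} eq = ≡.cong suc (f-inj eq)

    pg : ∀ i → P (g i)
    pg zero    = pn
    pg (suc i) = pf i

  -- Polynomials in one variable

  Polynomial : Set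
  Polynomial = List Carrier

  ⟦_⟧ : Polynomial → Carrier → Carrier
  ⟦ [] ⟧     s = 0#
  ⟦ a ∷ as ⟧ s = a + s * ⟦ as ⟧ s

  scaleᵖ : Carrier → Polynomial → Polynomial
  scaleᵖ c = map (c *_)

  _+ᵖ_ : Polynomial → Polynomial → Polynomial
  []       +ᵖ bs       = bs
  (a ∷ as) +ᵖ []       = a ∷ as
  (a ∷ as) +ᵖ (b ∷ bs) = a + b ∷ as +ᵖ bs

  _*ᵖ_ : Polynomial → Polynomial → Polynomial
  []       *ᵖ bs = []
  (a ∷ as) *ᵖ bs = scaleᵖ a bs +ᵖ (0# ∷ as *ᵖ bs)

  ⟦scale⟧ : ∀ c as s → ⟦ scaleᵖ c as ⟧ s ≈ c * ⟦ as ⟧ s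
  ⟦scale⟧ c []       s = sym (zeroʳ c)
  ⟦scale⟧ c (a ∷ as) s = trans (+-congˡ (*-congˡ (⟦scale⟧ c as s)))
    (solve 4 (λ c a s p → c :* a :+ s :* (c :* p) := c :* (a :+ s :* p)) refl c a s (⟦ as ⟧ s))

  ⟦+⟧ : ∀ as bs s → ⟦ as +ᵖ bs ⟧ s ≈ ⟦ as ⟧ s + ⟦ bs ⟧ s
  ⟦+⟧ []       bs       s = sym (+-identityˡ _)
  ⟦+⟧ (a ∷ as) []       s = sym (+-identityʳ _)
  ⟦+⟧ (a ∷ as) (b ∷ bs) s = trans (+-congˡ (*-congˡ (⟦+⟧ as bs s)))
    (solve 5 (λ a b s p q → (a :+ b) :+ s :* (p :+ q) := (a :+ s :* p) :+ (b :+ s :* q))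
      refl a b s (⟦ as ⟧ s) (⟦ bs ⟧ s))

  ⟦*⟧ : ∀ as bs s → ⟦ as *ᵖ bs ⟧ s ≈ ⟦ as ⟧ s * ⟦ bs ⟧ s
  ⟦*⟧ []       bs s = sym (zeroˡ _)
  ⟦*⟧ (a ∷ as) bs s = trans (⟦+⟧ (scaleᵖ a bs) (0# ∷ as *ᵖ bs) s)
    (trans (+-cong (⟦scale⟧ a bs s) (+-congˡ (*-congˡ (⟦*⟧ as bs s))))
    (solve 4 (λ a s p q → a :* q :+ (con (+ 0) :+ s :* (p :* q)) := (a :+ s :* p) :* q)
      refl a s (⟦ as ⟧ s) (⟦ bs ⟧ s)))

  -- The coefficients of (s p(s) − r p(r)) / (s − r), that is, the quotient on
  -- division of any a + s p(s) by s − r.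
  quotient : Carrier → Polynomial → Polynomial
  quotient r []       = []
  quotient r (a ∷ as) = ⟦ a ∷ as ⟧ r ∷ quotient r as

  length-quotient : ∀ r as → length (quotient r as) ≡ length as
  length-quotient r []       = ≡.refl
  length-quotient r (a ∷ as) = ≡.cong suc (length-quotient r as)

  ⟦⟧-quotient : ∀ a as r s → ⟦ a ∷ as ⟧ s ≈ ⟦ a ∷ as ⟧ r + (s - r) * ⟦ quotient r as ⟧ s
  ⟦⟧-quotient a []       r s =
    solve 3 (λ a r s → a :+ s :* con (+ 0) := (a :+ r :* con (+ 0)) :+ (s :- r) :* con (+ 0))
      refl a r s
  ⟦⟧-quotient a (b ∷ as) r s = trans (+-congˡ (*-congˡ (⟦⟧-quotient b as r s)))
    (solve 5 (λ a r s p q → a :+ s :* (p :+ (s :- r) :* q)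
                         := (a :+ r :* p) :+ (s :- r) :* (p :+ s :* q))
      refl a r s (⟦ b ∷ as ⟧ r) (⟦ quotient r as ⟧ s))

  -- If some `ι n₀` is a root, the factor s - `ι n₀` splits off. The quotient is still nonzero at
  -- `s₀`, so induction applies to it, and beyond `n₀` the factor is nonzero because `ι` is
  -- injective.
  polynomial-eventually-nonzero : ∀ as s₀ → ⟦ as ⟧ s₀ ≉ 0# → Eventually λ n → ⟦ as ⟧ (ι n) ≉ 0#
  polynomial-eventually-nonzero as = go (length as) as ≡.refl
    where
    -- `quotient r as` is not a subterm of the dividend, so the recursion runs over the length.
    go : ∀ k as → length as ≡ k → ∀ s₀ → ⟦ as ⟧ s₀ ≉ 0# → Eventually λ n → ⟦ as ⟧ (ι n) ≉ 0#
    go _       []       _     s₀ ≉0 = contradiction refl ≉0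
    go (suc k) (a ∷ as) len s₀ ≉0 with em {P = ∃ λ n → ⟦ a ∷ as ⟧ (ι n) ≈ 0#}
    ... | no  no-root    = 0 , λ n _ root → no-root (n , root)
    ... | yes (n₀ , root) = eventually-map step
        (eventually-∧ (suc n₀ , λ n n₀<n → n₀<n)
          (go k (quotient r as) (≡.trans (length-quotient r as) (ℕₚ.suc-injective len)) s₀
            λ q≈0 → ≉0 (trans (factor s₀) (trans (*-congˡ q≈0) (zeroʳ _)))))
      where
      r = ι n₀

      factor : ∀ s → ⟦ a ∷ as ⟧ s ≈ (s - r) * ⟦ quotient r as ⟧ s
      factor s = trans (⟦⟧-quotient a as r s) (trans (+-congʳ root) (+-identityˡ _))

      step : ∀ n → n₀ ℕ.< n × ⟦ quotient r as ⟧ (ι n) ≉ 0# → ⟦ a ∷ as ⟧ (ι n) ≉ 0#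
      step n (n₀<n , q≉0) p≈0 = *-nonzero
        (λ d≈0 → ℕₚ.<⇒≢ n₀<n (≡.sym (ι-injective (x∙y⁻¹≈ε⇒x≈y _ _ d≈0)))) q≉0
        (trans (sym (factor (ι n))) p≈0)

  -- Homogeneous polynomials on lines

  module _ {V : VectorSpace} where
    open LeftModule V

    evaluate-cong : ∀ {d} (p : Homogeneous V d) {v w} → v ≈ᴹ w → evaluate V p v ≈ evaluate V p w
    evaluate-cong (constant c) e = refl
    evaluate-cong (form α)     e = LinearForm.⟦⟧-cong α e
    evaluate-cong (p ⊞ q)      e = +-cong (evaluate-cong p e) (evaluate-cong q e)
    evaluate-cong (p ⊠ q)      e = *-cong (evaluate-cong p e) (evaluate-cong q e)

    restrict : ∀ {d} (p : Homogeneous V d) v w →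
               ∃ λ as → ∀ s → evaluate V p (v +ᴹ s *ₗ w) ≈ ⟦ as ⟧ s
    restrict (constant c) v w = c ∷ [] , λ s → sym (trans (+-congˡ (zeroʳ s)) (+-identityʳ c))
    restrict (form α)     v w = apply α v ∷ apply α w ∷ [] , λ s →
      trans (α.+ᴹ-homo v (s *ₗ w)) (+-congˡ (trans (α.*ₗ-homo s w)
        (*-congˡ (sym (trans (+-congˡ (zeroʳ s)) (+-identityʳ _))))))
      where module α = LinearForm α
    restrict (p ⊞ q) v w with restrict p v w | restrict q v w
    ... | as , as-spec | bs , bs-spec =
      as +ᵖ bs , λ s → trans (+-cong (as-spec s) (bs-spec s)) (sym (⟦+⟧ as bs s))
    restrict (p ⊠ q) v w with restrict p v w | restrict q v w
    ... | as , as-spec | bs , bs-spec =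
      as *ᵖ bs , λ s → trans (*-cong (as-spec s) (bs-spec s)) (sym (⟦*⟧ as bs s))

    line-at-0 : ∀ v w → v +ᴹ 0# *ₗ w ≈ᴹ v
    line-at-0 v w = ≈ᴹ-trans (+ᴹ-congˡ (*ₗ-zeroˡ w)) (+ᴹ-identityʳ v)

    line-at-1 : ∀ v w → v +ᴹ 1# *ₗ (w +ᴹ -ᴹ v) ≈ᴹ w
    line-at-1 v w = begin
      v +ᴹ 1# *ₗ (w +ᴹ -ᴹ v)  ≈⟨ +ᴹ-congˡ (*ₗ-identityˡ _) ⟩
      v +ᴹ (w +ᴹ -ᴹ v)        ≈⟨ +ᴹ-assoc v w (-ᴹ v) ⟨
      (v +ᴹ w) +ᴹ -ᴹ v        ≈⟨ xyx⁻¹≈y v w ⟩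
      w                       ∎
      where
      open SetoidReasoning ≈ᴹ-setoid
      open AbelianGroupProperties +ᴹ-abelianGroup using (xyx⁻¹≈y)

    evaluate-eventually-nonzero : ∀ {d} (p : Homogeneous V d) v w s₀ →
      evaluate V p (v +ᴹ s₀ *ₗ w) ≉ 0# → Eventually λ n → evaluate V p (v +ᴹ ι n *ₗ w) ≉ 0#
    evaluate-eventually-nonzero p v w s₀ ≉0 with restrict p v w
    ... | as , as-spec = eventually-map (λ n ≉0′ ≈0 → ≉0′ (trans (sym (as-spec (ι n))) ≈0))
      (polynomial-eventually-nonzero as s₀ λ ≈0 → ≉0 (trans (as-spec s₀) ≈0))

    -- Two nonempty basic open sets meet: on the line through `v` and `w`, `p` is nonzero at
    -- parameter 0 and `q` at parameter 1, hence both are at almost all `ι n`.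
    common-nonzero : ∀ {d e} (p : Homogeneous V d) (q : Homogeneous V e) v w →
      evaluate V p v ≉ 0# → evaluate V q w ≉ 0# →
      ∃ λ s → evaluate V (p ⊠ q) (v +ᴹ s *ₗ (w +ᴹ -ᴹ v)) ≉ 0#
    common-nonzero p q v w pv≉0 qw≉0 with eventually-inhabited (eventually-∧
        (evaluate-eventually-nonzero p v (w +ᴹ -ᴹ v) 0#
          λ ≈0 → pv≉0 (trans (evaluate-cong p (≈ᴹ-sym (line-at-0 v _))) ≈0))
        (evaluate-eventually-nonzero q v (w +ᴹ -ᴹ v) 1#
          λ ≈0 → qw≉0 (trans (evaluate-cong q (≈ᴹ-sym (line-at-1 v w))) ≈0)))
    ... | n , p≉0 , q≉0 = ι n , *-nonzero p≉0 q≉0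

  -- Linear combinations and codimension

  NonTrivial : ∀ {n} → (Fin n → Carrier) → Set
  NonTrivial c = ∃ λ i → c i ≉ 0#

  ¬nontrivial⇒≈0 : ∀ {n} {c : Fin n → Carrier} → ¬ NonTrivial c → ∀ i → c i ≈ 0#
  ¬nontrivial⇒≈0 ¬nt i = dne λ c≉0 → ¬nt (i , c≉0)

  module _ {H : VectorSpace} where
    open LeftModule H
    open Sum +ᴹ-commutativeMonoid using (sum-cong-≋; sum-remove)
    open CommutativeSemigroupProperties
      (CommutativeMonoid.commutativeSemigroup +ᴹ-commutativeMonoid) using (interchange)
    open SetoidReasoning ≈ᴹ-setoid

    private
      lc : ∀ {n} → (Fin n → Carrier) → (Fin n → Carrierᴹ) → Carrierᴹ
      lc = linearCombination H

    lc-cong : ∀ {n} {c d : Fin n → Carrier} x → (∀ i → c i ≈ d i) → lc c x ≈ᴹ lc d x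
    lc-cong x p = sum-cong-≋ λ i → *ₗ-congʳ (p i)

    lc-zero : ∀ {n} (c : Fin n → Carrier) x → (∀ i → c i ≈ 0#) → lc c x ≈ᴹ 0ᴹ
    lc-zero {zero}  c x c≈0 = ≈ᴹ-refl
    lc-zero {suc n} c x c≈0 = ≈ᴹ-trans
      (+ᴹ-cong (≈ᴹ-trans (*ₗ-congʳ (c≈0 zero)) (*ₗ-zeroˡ _)) (lc-zero (c ∘ suc) (x ∘ suc) (c≈0 ∘ suc)))
      (+ᴹ-identityˡ _)

    lc-head : ∀ {n} (c : Fin (suc n) → Carrier) x → (∀ i → c (suc i) ≈ 0#) →
              lc c x ≈ᴹ c zero *ₗ x zero
    lc-head c x c≈0 = ≈ᴹ-trans (+ᴹ-congˡ (lc-zero (c ∘ suc) (x ∘ suc) c≈0)) (+ᴹ-identityʳ _)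

    lc-tail : ∀ {n} (c : Fin (suc n) → Carrier) x → c zero ≈ 0# →
              lc c x ≈ᴹ lc (c ∘ suc) (x ∘ suc)
    lc-tail c x c≈0 = ≈ᴹ-trans (+ᴹ-congʳ (≈ᴹ-trans (*ₗ-congʳ c≈0) (*ₗ-zeroˡ _))) (+ᴹ-identityˡ _)

    lc-+* : ∀ {n} (c d : Fin n → Carrier) a x →
            lc c x +ᴹ a *ₗ lc d x ≈ᴹ lc (λ i → c i + a * d i) x
    lc-+* {zero}  c d a x = ≈ᴹ-trans (+ᴹ-identityˡ _) (*ₗ-zeroʳ a)
    lc-+* {suc n} c d a x = begin
      (c zero *ₗ x zero +ᴹ c′) +ᴹ a *ₗ (d zero *ₗ x zero +ᴹ d′)
        ≈⟨ +ᴹ-congˡ (*ₗ-distribˡ a _ _) ⟩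
      (c zero *ₗ x zero +ᴹ c′) +ᴹ (a *ₗ (d zero *ₗ x zero) +ᴹ a *ₗ d′)
        ≈⟨ interchange _ _ _ _ ⟩
      (c zero *ₗ x zero +ᴹ a *ₗ (d zero *ₗ x zero)) +ᴹ (c′ +ᴹ a *ₗ d′)
        ≈⟨ +ᴹ-cong (+ᴹ-congˡ (≈ᴹ-sym (*ₗ-assoc a _ _))) (lc-+* (c ∘ suc) (d ∘ suc) a (x ∘ suc)) ⟩
      (c zero *ₗ x zero +ᴹ (a * d zero) *ₗ x zero) +ᴹ _
        ≈⟨ +ᴹ-congʳ (*ₗ-distribʳ (x zero) _ _) ⟨
      lc (λ i → c i + a * d i) x ∎
      where
      c′ = lc (c ∘ suc) (x ∘ suc)
      d′ = lc (d ∘ suc) (x ∘ suc)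

    lc-* : ∀ {n} a (c : Fin n → Carrier) x → a *ₗ lc c x ≈ᴹ lc (λ i → a * c i) x
    lc-* a c x = begin
      a *ₗ lc c x                       ≈⟨ +ᴹ-identityˡ _ ⟨
      0ᴹ +ᴹ a *ₗ lc c x                 ≈⟨ +ᴹ-congʳ (lc-zero (λ _ → 0#) x λ _ → refl) ⟨
      lc (λ _ → 0#) x +ᴹ a *ₗ lc c x    ≈⟨ lc-+* (λ _ → 0#) c a x ⟩
      lc (λ i → 0# + a * c i) x         ≈⟨ lc-cong x (λ i → +-identityˡ (a * c i)) ⟩
      lc (λ i → a * c i) x              ∎

    lc-+ : ∀ {n} (c d : Fin n → Carrier) x → lc c x +ᴹ lc d x ≈ᴹ lc (λ i → c i + d i) x
    lc-+ c d x = begin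
      lc c x +ᴹ lc d x                  ≈⟨ +ᴹ-congˡ (*ₗ-identityˡ _) ⟨
      lc c x +ᴹ 1# *ₗ lc d x            ≈⟨ lc-+* c d 1# x ⟩
      lc (λ i → c i + 1# * d i) x       ≈⟨ lc-cong x (λ i → +-congˡ (*-identityˡ (d i))) ⟩
      lc (λ i → c i + d i) x            ∎

    -- The coefficient of `v` stays existential: it becomes the coefficient at the pivot in
    -- `dependent`, where any value serves.
    lc-shift : ∀ {n} (c r : Fin n → Carrier) x v →
               ∃ λ a → lc c (λ i → x i +ᴹ r i *ₗ v) ≈ᴹ a *ₗ v +ᴹ lc c x
    lc-shift {zero}  c r x v = 0# , ≈ᴹ-sym (≈ᴹ-trans (+ᴹ-identityʳ _) (*ₗ-zeroˡ v))
    lc-shift {suc n} c r x v with lc-shift (c ∘ suc) (r ∘ suc) (x ∘ suc) v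
    ... | a , ih = c zero * r zero + a , (begin
      c zero *ₗ (x zero +ᴹ r zero *ₗ v) +ᴹ lc (c ∘ suc) (λ i → x (suc i) +ᴹ r (suc i) *ₗ v)
        ≈⟨ +ᴹ-cong (≈ᴹ-trans (*ₗ-distribˡ _ _ _) (+ᴹ-comm _ _)) ih ⟩
      (c zero *ₗ (r zero *ₗ v) +ᴹ c zero *ₗ x zero) +ᴹ (a *ₗ v +ᴹ lc (c ∘ suc) (x ∘ suc))
        ≈⟨ interchange _ _ _ _ ⟩
      (c zero *ₗ (r zero *ₗ v) +ᴹ a *ₗ v) +ᴹ lc c x
        ≈⟨ +ᴹ-congʳ (+ᴹ-congʳ (≈ᴹ-sym (*ₗ-assoc _ _ v))) ⟩
      ((c zero * r zero) *ₗ v +ᴹ a *ₗ v) +ᴹ lc c x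
        ≈⟨ +ᴹ-congʳ (*ₗ-distribʳ v _ _) ⟨
      (c zero * r zero + a) *ₗ v +ᴹ lc c x ∎)

    lc-insertAt : ∀ {n} (c : Fin n → Carrier) p a x →
                  lc (insertAt c p a) x ≈ᴹ a *ₗ x p +ᴹ lc c (removeAt x p)
    lc-insertAt c p a x = ≈ᴹ-trans (sum-remove {i = p} (λ i → insertAt c p a i *ₗ x i))
      (+ᴹ-cong (*ₗ-congʳ (reflexive (insertAt-lookup c p a)))
               (lc-cong (removeAt x p) λ i → reflexive (insertAt-punchIn c p a i)))

    -- Gaussian elimination on the coefficient of `g zero`. If no `x i` involves `g zero`, the
    -- element `x zero` can be left out. Otherwise multiples of a pivot `x p` are subtracted from
    -- the other elements, and the relation found for these is completed by a coefficient at p.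
    dependent : ∀ {n} (g : Fin n → Carrierᴹ) (x : Fin (suc n) → Carrierᴹ) →
                (∀ i → ∃ λ a → x i ≈ᴹ lc a g) → ∃ λ c → NonTrivial c × lc c x ≈ᴹ 0ᴹ
    dependent {zero} g x x∈g = (λ _ → 1#) , (zero , λ 1≈0 → 0≉1 (sym 1≈0)) ,
      ≈ᴹ-trans (+ᴹ-identityʳ _) (≈ᴹ-trans (*ₗ-identityˡ _) (proj₂ (x∈g zero)))
    dependent {suc n} g x x∈g with em {P = ∃ λ p → proj₁ (x∈g p) zero ≉ 0#}
    ... | no no-pivot
      with dependent (g ∘ suc) (x ∘ suc) (λ i → proj₁ (x∈g (suc i)) ∘ suc ,
             ≈ᴹ-trans (proj₂ (x∈g (suc i)))
               (lc-tail (proj₁ (x∈g (suc i))) g (dne λ ≉0 → no-pivot (suc i , ≉0))))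
    ...   | c , (i , c≉0) , c≈0 = insertAt c zero 0# , (suc i , c≉0) ,
              ≈ᴹ-trans (lc-tail (insertAt c zero 0#) x refl) c≈0
    dependent {suc n} g x x∈g | yes (p , a≉0) with inverse _ a≉0
    ... | u , au≈1 with dependent (g ∘ suc) y y∈g
      where
      r : Fin (suc n) → Carrier
      r i = - (proj₁ (x∈g (Fin.punchIn p i)) zero * u)

      y : Fin (suc n) → Carrierᴹ
      y i = removeAt x p i +ᴹ r i *ₗ x p

      y∈g : ∀ i → ∃ λ a → y i ≈ᴹ lc a (g ∘ suc)
      y∈g i with x∈g (Fin.punchIn p i)
      ... | b , x≈ = (λ j → b (suc j) + r′ * proj₁ (x∈g p) (suc j)) , (begin
        removeAt x p i +ᴹ r′ *ₗ x p
          ≈⟨ +ᴹ-cong x≈ (*ₗ-congˡ (proj₂ (x∈g p))) ⟩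
        lc b g +ᴹ r′ *ₗ lc (proj₁ (x∈g p)) g
          ≈⟨ lc-+* b (proj₁ (x∈g p)) r′ g ⟩
        lc (λ j → b j + r′ * proj₁ (x∈g p) j) g
          ≈⟨ lc-tail (λ j → b j + r′ * proj₁ (x∈g p) j) g (trans
               (solve 3 (λ b a u → b :+ :- (b :* u) :* a := b :* (con (+ 1) :- a :* u))
                 refl (b zero) (proj₁ (x∈g p) zero) u)
               (trans (*-congˡ (trans (+-cong (+-identityʳ 1#) (-‿cong au≈1)) (-‿inverseʳ 1#)))
                      (zeroʳ _))) ⟩
        lc (λ j → b (suc j) + r′ * proj₁ (x∈g p) (suc j)) (g ∘ suc) ∎)
        where r′ = - (b zero * u)
    ...   | c , (i , c≉0) , c≈0
      with lc-shift c (λ i → - (proj₁ (x∈g (Fin.punchIn p i)) zero * u)) (removeAt x p) (x p)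
    ...     | a , shift = insertAt c p a ,
              (Fin.punchIn p i , λ ≈0 → c≉0 (trans (reflexive (≡.sym (insertAt-punchIn c p a i))) ≈0)) ,
              ≈ᴹ-trans (lc-insertAt c p a x) (≈ᴹ-trans (≈ᴹ-sym shift) c≈0)

    infix 4 _⊆_
    _⊆_ : Subspace H → Subspace H → Set
    N ⊆ N′ = ∀ {z} → Member N z → Member N′ z

    module _ (N : Subspace H) where
      private module N = Subspace N

      unscale : ∀ {c z} → c ≉ 0# → Member N (c *ₗ z) → Member N z
      unscale {c} {z} c≉0 cz∈N with inverse c c≉0
      ... | c⁻¹ , cc⁻¹≈1 = N.≈ᴹ-closed
        (≈ᴹ-trans (≈ᴹ-sym (*ₗ-assoc c⁻¹ c z))
          (≈ᴹ-trans (*ₗ-congʳ (trans (*-comm c⁻¹ c) cc⁻¹≈1)) (*ₗ-identityˡ z)))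
        (N.*ₗ-closed c⁻¹ cz∈N)

      cancelˡ : ∀ c {z w} → Member N z → Member N (c *ₗ z +ᴹ w) → Member N w
      cancelˡ c {z} {w} z∈N cz+w∈N = N.≈ᴹ-closed (begin
        - c *ₗ z +ᴹ (c *ₗ z +ᴹ w)   ≈⟨ +ᴹ-assoc _ _ w ⟨
        (- c *ₗ z +ᴹ c *ₗ z) +ᴹ w   ≈⟨ +ᴹ-congʳ (*ₗ-distribʳ z (- c) c) ⟨
        (- c + c) *ₗ z +ᴹ w         ≈⟨ +ᴹ-congʳ (*ₗ-congʳ (-‿inverseˡ c)) ⟩
        0# *ₗ z +ᴹ w                ≈⟨ +ᴹ-congʳ (*ₗ-zeroˡ z) ⟩
        0ᴹ +ᴹ w                     ≈⟨ +ᴹ-identityˡ w ⟩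
        w                           ∎)
        (N.+ᴹ-closed (N.*ₗ-closed (- c) z∈N) cz+w∈N)

      -- If only `c zero` were nonzero, `c zero *ₗ x zero` would lie in N, and so would `x zero`.
      nontrivial-tail : ∀ {n} (c : Fin (suc n) → Carrier) x → ¬ Member N (x zero) →
                        NonTrivial c → Member N (lc c x) → NonTrivial (c ∘ suc)
      nontrivial-tail c x x₀∉N (suc i , c≉0) cx∈N = i , c≉0
      nontrivial-tail c x x₀∉N (zero , c≉0)  cx∈N = dne λ trivial →
        x₀∉N (unscale c≉0 (N.≈ᴹ-closed (lc-head c x (¬nontrivial⇒≈0 trivial)) cx∈N))

      -- Any n + 1 elements are dependent modulo N, that is, dim (H / N) is at most n, without a
      -- quotient or a basis of it. For the kernel of a family this bounds the rank of the family.
      CodimAtMost : ℕ → Set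
      CodimAtMost n = ∀ (x : Fin (suc n) → Carrierᴹ) → ∃ λ c → NonTrivial c × Member N (lc c x)

    codim≤dim : ∀ {n} → dim whole H ≡ n → ∀ N → CodimAtMost N n
    codim≤dim (b , basis) N x with dependent b x (λ i → spanning (x i) _)
      where open IsBasis basis
    ... | c , nt , cx≈0 = c , nt , N.≈ᴹ-closed (≈ᴹ-sym cx≈0) N.0ᴹ-closed
      where module N = Subspace N

    codim-antitone : ∀ {n N N′} → N ⊆ N′ → CodimAtMost N n → CodimAtMost N′ n
    codim-antitone N⊆N′ codim x with codim x
    ... | c , nt , cx∈N = c , nt , N⊆N′ cx∈N

    -- With `z` in front of the given elements, a relation modulo N involves one of them, as z is
    -- not in N. Modulo N′ the term of z disappears.
    codim-drop : ∀ {n} N N′ → N ⊆ N′ → ∀ {z} → ¬ Member N z → Member N′ z →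
                 CodimAtMost N (suc n) → CodimAtMost N′ n
    codim-drop N N′ N⊆N′ {z} z∉N z∈N′ codim x with codim (insertAt x zero z)
    ... | c , nt , cx∈N =
      c ∘ suc , nontrivial-tail N c (insertAt x zero z) z∉N nt cx∈N , cancelˡ N′ (c zero) z∈N′ (N⊆N′ cx∈N)

    -- The argument of `codim-drop` with two elements in front, which saves the intermediate
    -- subspace spanned by N and one of them.
    codim-drop₂ : ∀ {n} N N′ → N ⊆ N′ → ∀ {y z} → Member N′ y → Member N′ z →
                  (∀ a b → Member N (a *ₗ y +ᴹ b *ₗ z) → a ≈ 0# × b ≈ 0#) →
                  CodimAtMost N (suc (suc n)) → CodimAtMost N′ n
    codim-drop₂ N N′ N⊆N′ {y} {z} y∈N′ z∈N′ independent codim x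
      with codim (insertAt (insertAt x zero z) zero y)
    ... | c , (i , c≉0) , cx∈N = (λ i → c (suc (suc i))) , dne nontrivial ,
            cancelˡ N′ (c (suc zero)) z∈N′ (cancelˡ N′ (c zero) y∈N′ (N⊆N′ cx∈N))
      where
      nontrivial : ¬ ¬ NonTrivial (λ i → c (suc (suc i)))
      nontrivial trivial
        with independent (c zero) (c (suc zero)) (Subspace.≈ᴹ-closed N
               (+ᴹ-congˡ (lc-head (c ∘ suc) (insertAt x zero z) (¬nontrivial⇒≈0 trivial))) cx∈N)
      ... | c₀≈0 , c₁≈0 = c≉0 (c≈0 i)
        where
        c≈0 : ∀ i → c i ≈ 0#
        c≈0 zero          = c₀≈0
        c≈0 (suc zero)    = c₁≈0
        c≈0 (suc (suc i)) = ¬nontrivial⇒≈0 trivial i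

    -- Meant for γ = α + t β and `r i` = 1 / (t - s i): where α + s i β vanishes, γ equals (t - s i)
    -- β.
    apply-reweighted : ∀ (γ β : LinearForm H) {n} (c r : Fin n → Carrier) x →
      (∀ i → r i * apply γ (x i) ≈ apply β (x i)) →
      apply γ (lc (λ i → c i * r i) x) ≈ apply β (lc c x)
    apply-reweighted γ β {zero}  c r x h =
      trans (LinearForm.0ᴹ-homo γ) (sym (LinearForm.0ᴹ-homo β))
    apply-reweighted γ β {suc n} c r x h =
      trans (γ.+ᴹ-homo _ _) (trans
        (+-cong
          (trans (γ.*ₗ-homo _ _) (trans (*-assoc _ _ _)
            (trans (*-congˡ (h zero)) (sym (β.*ₗ-homo _ _)))))
          (apply-reweighted γ β (c ∘ suc) (r ∘ suc) (x ∘ suc) (h ∘ suc)))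
        (sym (β.+ᴹ-homo _ _)))
      where
      module γ = LinearForm γ
      module β = LinearForm β

    -- From a relation Σ cᵢ xᵢ ∈ N one gets y = Σ cᵢ (t − sᵢ)⁻¹ xᵢ in the kernel of
    -- α + t β.  If y ∈ N, then Σ cᵢ xᵢ + (s₀ − t) y ∈ N is a relation among
    -- the xᵢ with i ≠ 0.
    pencil-kernel : ∀ {X : Set} (α β : X → LinearForm H) (N : Subspace H) →
      (∀ {z} → Member N z → ∀ w → apply (β w) z ≈ 0#) →
      ∀ {n} (x : Fin n → Carrierᴹ) (s : Fin n → Carrier) → (∀ {i j} → s i ≈ s j → i ≡ j) →
      (∀ i → ¬ Member N (x i)) → (∀ i w → apply (α w) (x i) + s i * apply (β w) (x i) ≈ 0#) →
      ∀ c → NonTrivial c → Member N (lc c x) →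
      ∀ t → ∃ λ z → ¬ Member N z × (∀ w → apply (α w) z + t * apply (β w) z ≈ 0#)
    pencil-kernel α β N N⊆β {zero}  x s s-inj x∉N x∈ker c (() , _) cx∈N t
    pencil-kernel α β N N⊆β {suc n} x s s-inj x∉N x∈ker c nt cx∈N t with em {P = ∃ λ i → s i ≈ t}
    ... | yes (i , s≈t) = x i , x∉N i , λ w → trans (+-congˡ (*-congʳ (sym s≈t))) (x∈ker i w)
    ... | no s≉t = decide em
      where
      reciprocal : ∀ i → ∃ λ r → (t - s i) * r ≈ 1#
      reciprocal i = inverse (t - s i) λ ≈0 → s≉t (i , sym (x∙y⁻¹≈ε⇒x≈y _ _ ≈0))

      r : Fin (suc n) → Carrier
      r i = proj₁ (reciprocal i)

      tr≈1 : ∀ i → (t - s i) * r i ≈ 1#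
      tr≈1 i = proj₂ (reciprocal i)

      r≉0 : ∀ i → r i ≉ 0#
      r≉0 i r≈0 = 0≉1 (trans (sym (trans (*-congˡ r≈0) (zeroʳ _))) (tr≈1 i))

      y : Carrierᴹ
      y = lc (λ i → c i * r i) x

      reweight : ∀ w i → r i * (apply (α w) (x i) + t * apply (β w) (x i)) ≈ apply (β w) (x i)
      reweight w i = trans
        (solve 5 (λ r a b s t → r :* (a :+ t :* b) := r :* (a :+ s :* b) :+ ((t :- s) :* r) :* b)
          refl (r i) (apply (α w) (x i)) (apply (β w) (x i)) (s i) t)
        (trans (+-cong (trans (*-congˡ (x∈ker i w)) (zeroʳ _))
                       (trans (*-congʳ (tr≈1 i)) (*-identityˡ _)))
               (+-identityˡ _))

      c′ : Fin (suc n) → Carrier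
      c′ i = c i + (s zero - t) * (c i * r i)

      -- `c′ i` is `c i` (s 0 - s i) / (t - s i): zero at i = 0, and nonzero wherever else `c i` is,
      -- as the `s i` are distinct.
      c′≈ : ∀ i → c′ i ≈ c i * ((s zero - s i) * r i)
      c′≈ i = trans
        (solve 5 (λ t s₀ s c r → c :+ (s₀ :- t) :* (c :* r)
                              := c :* ((s₀ :- s) :* r) :+ c :* (con (+ 1) :- (t :- s) :* r))
          refl t (s zero) (s i) (c i) (r i))
        (trans (+-congˡ (trans (*-congˡ (trans
          (+-cong (+-identityʳ 1#) (-‿cong (tr≈1 i))) (-‿inverseʳ 1#))) (zeroʳ _)))
          (+-identityʳ _))

      c′₀≈0 : c′ zero ≈ 0#
      c′₀≈0 = trans (c′≈ zero)
        (trans (*-congˡ (trans (*-congʳ (-‿inverseʳ (s zero))) (zeroˡ _))) (zeroʳ _))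

      nontrivial : NonTrivial (c′ ∘ suc)
      nontrivial with nontrivial-tail N c x (x∉N zero) nt cx∈N
      ... | i , c≉0 = i , λ c′≈0 → *-nonzero c≉0
        (*-nonzero (λ ≈0 → contradiction (s-inj (x∙y⁻¹≈ε⇒x≈y _ _ ≈0)) λ ()) (r≉0 (suc i)))
        (trans (sym (c′≈ (suc i))) c′≈0)

      suc-injective : ∀ {i j} → s (suc i) ≈ s (suc j) → i ≡ j
      suc-injective e with s-inj e
      ... | ≡.refl = ≡.refl

      decide : Dec (Member N y) →
               ∃ λ z → ¬ Member N z × (∀ w → apply (α w) z + t * apply (β w) z ≈ 0#)
      -- The value of α + t β at `y` is the value of β at the relation, which vanishes because the
      -- relation lies in N.
      decide (no y∉N) = y , y∉N , λ w →
        trans (apply-reweighted (α w +ᴰ t *ᴰ β w) (β w) c r x (reweight w)) (N⊆β cx∈N w)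
        where open LeftModule (Dual H) using () renaming (_+ᴹ_ to _+ᴰ_; _*ₗ_ to _*ᴰ_)
      decide (yes y∈N) =
        pencil-kernel α β N N⊆β (x ∘ suc) (s ∘ suc) suc-injective (x∉N ∘ suc) (x∈ker ∘ suc)
          (c′ ∘ suc) nontrivial
          (N.≈ᴹ-closed (≈ᴹ-trans (lc-+* c (λ i → c i * r i) (s zero - t) x) (lc-tail c′ x c′₀≈0))
            (N.+ᴹ-closed cx∈N (N.*ₗ-closed (s zero - t) y∈N)))
          t
        where module N = Subspace N

  -- Coordinates on a two-dimensional space

  record Plane (V : VectorSpace) : Set where
    open LeftModule V
    field
      b₀ b₁  : Carrierᴹ
      x₀ x₁  : LinearForm V
      expand : ∀ v → v ≈ᴹ apply x₀ v *ₗ b₀ +ᴹ apply x₁ v *ₗ b₁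
      x₀b₀≈1 : apply x₀ b₀ ≈ 1#
      x₀b₁≈0 : apply x₀ b₁ ≈ 0#
      x₁b₀≈0 : apply x₁ b₀ ≈ 0#
      x₁b₁≈1 : apply x₁ b₁ ≈ 1#

    x₀b₀≉0 : apply x₀ b₀ ≉ 0#
    x₀b₀≉0 x₀b₀≈0 = 0≉1 (trans (sym x₀b₀≈0) x₀b₀≈1)

    x₀-zero : ∀ {v} → v ≈ᴹ 0ᴹ → apply x₀ v ≈ 0#
    x₀-zero v≈0 = trans (LinearForm.⟦⟧-cong x₀ v≈0) (LinearForm.0ᴹ-homo x₀)

    -- The determinant of u and v as a linear form in v. For u ≠ 0 its zero set is the line of u, so
    -- its nonvanishing expresses that u and v are independent.
    det : Carrierᴹ → LinearForm V
    det u = apply x₀ u *ᴰ x₁ +ᴰ (- apply x₁ u) *ᴰ x₀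
      where open LeftModule (Dual V) using () renaming (_+ᴹ_ to _+ᴰ_; _*ₗ_ to _*ᴰ_)

    det-nonzero : ∀ u → ¬ u ≈ᴹ 0ᴹ → ∃ λ v → apply (det u) v ≉ 0#
    det-nonzero u u≉0 with em {P = apply x₀ u ≈ 0#}
    ... | no x≉0 = b₁ , λ det≈0 → x≉0 (begin
      apply x₀ u                                            ≈⟨ *-identityʳ _ ⟨
      apply x₀ u * 1#                                       ≈⟨ *-congˡ x₁b₁≈1 ⟨
      apply x₀ u * apply x₁ b₁                              ≈⟨ +-identityʳ _ ⟨
      apply x₀ u * apply x₁ b₁ + 0#                         ≈⟨ +-congˡ (trans (*-congˡ x₀b₁≈0) (zeroʳ _)) ⟨
      apply (det u) b₁                                      ≈⟨ det≈0 ⟩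
      0#                                                    ∎)
      where open SetoidReasoning setoid
    ... | yes x≈0 = b₀ , λ det≈0 → u≉0 (begin
      u                                           ≈⟨ expand u ⟩
      apply x₀ u *ₗ b₀ +ᴹ apply x₁ u *ₗ b₁        ≈⟨ +ᴹ-cong (*ₗ-congʳ x≈0) (*ₗ-congʳ (x₁≈0 det≈0)) ⟩
      0# *ₗ b₀ +ᴹ 0# *ₗ b₁                        ≈⟨ +ᴹ-cong (*ₗ-zeroˡ b₀) (*ₗ-zeroˡ b₁) ⟩
      0ᴹ +ᴹ 0ᴹ                                    ≈⟨ +ᴹ-identityˡ 0ᴹ ⟩
      0ᴹ                                          ∎)
      where
      open SetoidReasoning ≈ᴹ-setoid
      x₁≈0 : apply (det u) b₀ ≈ 0# → apply x₁ u ≈ 0#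
      x₁≈0 det≈0 = trans
        (solve 2 (λ x₀ x₁ → x₁ := :- (x₀ :* con (+ 0) :+ :- x₁ :* con (+ 1)))
          refl (apply x₀ u) (apply x₁ u))
        (trans (-‿cong (trans
            (sym (+-cong (*-congˡ x₁b₀≈0) (*-congˡ (trans x₀b₀≈1 (sym (+-identityʳ 1#)))))) det≈0))
          ε⁻¹≈ε)
        where open AbelianGroupProperties +-abelianGroup using (ε⁻¹≈ε)

  module _ {V : VectorSpace} {n : ℕ} (dim-V : dim whole V ≡ n) where
    open LeftModule V
    open SetoidReasoning ≈ᴹ-setoid
    private
      b = proj₁ dim-V
      module B = IsBasis (proj₂ dim-V)

      lc : (Fin n → Carrier) → Carrierᴹ
      lc c = linearCombination V c b

    coefficients-unique : ∀ c d → lc c ≈ᴹ lc d → ∀ i → c i ≈ d i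
    coefficients-unique c d e i = x∙y⁻¹≈ε⇒x≈y _ _ (trans
      (solve 2 (λ c d → c :- d := c :+ :- con (+ 1) :* d) refl (c i) (d i))
      (trans (+-congˡ (*-congʳ (-‿cong (+-identityʳ 1#))))
      (B.independent (λ i → c i + - 1# * d i) (begin
        lc (λ i → c i + - 1# * d i)     ≈⟨ lc-+* {V} c d (- 1#) b ⟨
        lc c +ᴹ - 1# *ₗ lc d            ≈⟨ +ᴹ-cong (≈ᴹ-trans e (≈ᴹ-sym (*ₗ-identityˡ _))) ≈ᴹ-refl ⟩
        1# *ₗ lc d +ᴹ - 1# *ₗ lc d      ≈⟨ *ₗ-distribʳ _ _ _ ⟨
        (1# - 1#) *ₗ lc d               ≈⟨ *ₗ-congʳ (-‿inverseʳ 1#) ⟩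
        0# *ₗ lc d                      ≈⟨ *ₗ-zeroˡ _ ⟩
        0ᴹ                              ∎) i)))

    coefficients : Carrierᴹ → Fin n → Carrier
    coefficients v = proj₁ (B.spanning v _)

    expansion : ∀ v → v ≈ᴹ lc (coefficients v)
    expansion v = proj₂ (B.spanning v _)

    -- The coefficients are those chosen by the spanning property; their uniqueness makes the choice
    -- compatible with equality and linear.
    coefficient : Fin n → LinearForm V
    coefficient i = record
      { apply    = λ v → coefficients v i
      ; isLinear = linear V leftModule (λ v → coefficients v i)
          (λ {v} {w} e → coefficients-unique _ _ (begin
            lc (coefficients v)   ≈⟨ expansion v ⟨
            v                     ≈⟨ e ⟩
            w                     ≈⟨ expansion w ⟩
            lc (coefficients w)   ∎) i)
          (λ v w → coefficients-unique _ _ (begin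
            lc (coefficients (v +ᴹ w))                      ≈⟨ expansion (v +ᴹ w) ⟨
            v +ᴹ w                                          ≈⟨ +ᴹ-cong (expansion v) (expansion w) ⟩
            lc (coefficients v) +ᴹ lc (coefficients w)      ≈⟨ lc-+ {V} (coefficients v) (coefficients w) b ⟩
            lc (λ i → coefficients v i + coefficients w i)  ∎) i)
          (λ a v → coefficients-unique _ _ (begin
            lc (coefficients (a *ₗ v))        ≈⟨ expansion (a *ₗ v) ⟨
            a *ₗ v                            ≈⟨ *ₗ-congˡ (expansion v) ⟩
            a *ₗ lc (coefficients v)          ≈⟨ lc-* {V} a (coefficients v) b ⟩
            lc (λ i → a * coefficients v i)   ∎) i)
      }

  plane : ∀ {V} → dim whole V ≡ 2 → Plane V
  plane {V} dim-V@(b , basis) = record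
    { b₀ = b zero
    ; b₁ = b (suc zero)
    ; x₀ = coefficient dim-V zero
    ; x₁ = coefficient dim-V (suc zero)
    ; expand = λ v → ≈ᴹ-trans (expansion dim-V v) (+ᴹ-congˡ (+ᴹ-identityʳ _))
    ; x₀b₀≈1 = coefficients-unique dim-V (coefficients dim-V (b zero)) δ₀ b₀≈ zero
    ; x₀b₁≈0 = coefficients-unique dim-V (coefficients dim-V (b (suc zero))) δ₁ b₁≈ zero
    ; x₁b₀≈0 = coefficients-unique dim-V (coefficients dim-V (b zero)) δ₀ b₀≈ (suc zero)
    ; x₁b₁≈1 = coefficients-unique dim-V (coefficients dim-V (b (suc zero))) δ₁ b₁≈ (suc zero)
    }
    where
    open LeftModule V
    δ₀ δ₁ : Fin 2 → Carrier
    δ₀ zero    = 1#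
    δ₀ (suc _) = 0#
    δ₁ zero    = 0#
    δ₁ (suc _) = 1#

    b₀≈ : linearCombination V (coefficients dim-V (b zero)) b ≈ᴹ linearCombination V δ₀ b
    b₀≈ = ≈ᴹ-trans (≈ᴹ-sym (expansion dim-V (b zero)))
      (≈ᴹ-sym (≈ᴹ-trans (lc-head {V} δ₀ b λ _ → refl) (*ₗ-identityˡ _)))

    b₁≈ : linearCombination V (coefficients dim-V (b (suc zero))) b ≈ᴹ linearCombination V δ₁ b
    b₁≈ = ≈ᴹ-trans (≈ᴹ-sym (expansion dim-V (b (suc zero))))
      (≈ᴹ-sym (≈ᴹ-trans (lc-tail {V} δ₁ b refl) (≈ᴹ-trans (+ᴹ-identityʳ _) (*ₗ-identityˡ _))))

  -- Replacing one entry of a dependent tuple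

  module _ {m : ℕ} {A : Fin m → Set} where
    update : (∀ i → A i) → ∀ j → A j → ∀ i → A i
    update w j a i with i Finₚ.≟ j
    ... | yes ≡.refl = a
    ... | no  _      = w i

    update-same : ∀ w j a → update w j a j ≡ a
    update-same w j a with j Finₚ.≟ j
    ... | yes ≡.refl = ≡.refl
    ... | no  j≢j    = contradiction ≡.refl j≢j

    update-other : ∀ w {j} a {i} → i ≢ j → update w j a i ≡ w i
    update-other w {j} a {i} i≢j with i Finₚ.≟ j
    ... | yes i≡j = contradiction i≡j i≢j
    ... | no  _   = ≡.refl

    update-self : ∀ w j i → update w j (w j) i ≡ w i
    update-self w j i with i Finₚ.≟ j
    ... | yes ≡.refl = ≡.refl
    ... | no  _      = ≡.refl

    update-comm : ∀ w {j k} a b → j ≢ k → ∀ i →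
                  update (update w j a) k b i ≡ update (update w k b) j a i
    update-comm w {j} {k} a b j≢k i with i Finₚ.≟ k | i Finₚ.≟ j
    ... | yes ≡.refl | yes ≡.refl = contradiction ≡.refl j≢k
    ... | yes ≡.refl | no  i≢j    = ≡.sym (update-same w i b)
    ... | no  i≢k    | yes ≡.refl = update-same w i a
    ... | no  i≢k    | no  i≢j    = ≡.trans (update-other w a i≢j) (≡.sym (update-other w b i≢k))

  -- Families of functions of m vectors, parametrised linearly by H

  module Families {m : ℕ} (V : Fin m → VectorSpace) (planes : ∀ j → Plane (V j)) (H : VectorSpace) where
    private
      module V j = LeftModule (V j)
      module H = LeftModule H

    Arguments : Set
    Arguments = ∀ j → V.Carrierᴹ j

    Family : Set
    Family = Arguments → LinearForm H

    Congruent : Family → Set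
    Congruent T = ∀ {w w′} → (∀ i → V._≈ᴹ_ i (w i) (w′ i)) → ∀ z → apply (T w) z ≈ apply (T w′) z

    record LinearAt (T : Family) (j : Fin m) : Set where
      field
        additive    : ∀ w u v z → apply (T (update w j (V._+ᴹ_ j u v))) z
                                  ≈ apply (T (update w j u)) z + apply (T (update w j v)) z
        homogeneous : ∀ w s v z → apply (T (update w j (V._*ₗ_ j s v))) z
                                  ≈ s * apply (T (update w j v)) z

      linear-combination : ∀ w s u t v z →
        apply (T (update w j (V._+ᴹ_ j (V._*ₗ_ j s u) (V._*ₗ_ j t v)))) z
        ≈ s * apply (T (update w j u)) z + t * apply (T (update w j v)) z
      linear-combination w s u t v z =
        trans (additive w _ _ z) (+-cong (homogeneous w s u z) (homogeneous w t v z))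

      affine-combination : ∀ w u t v z →
        apply (T (update w j (V._+ᴹ_ j u (V._*ₗ_ j t v)))) z
        ≈ apply (T (update w j u)) z + t * apply (T (update w j v)) z
      affine-combination w u t v z = trans (additive w _ _ z) (+-congˡ (homogeneous w t v z))

    -- The result still takes m arguments but ignores the one in slot j, so the induction stays
    -- within one type and one space H. Linearity at j is lost, which is why it is recorded slot by
    -- slot.
    plug : Family → ∀ j → V.Carrierᴹ j → Family
    plug T j v w = T (update w j v)

    kernel : Family → Subspace H
    kernel T = record
      { Member    = λ z → ∀ w → apply (T w) z ≈ 0#
      ; ≈ᴹ-closed = λ z≈z′ p w → trans (sym (LinearForm.⟦⟧-cong (T w) z≈z′)) (p w)
      ; 0ᴹ-closed = λ w → LinearForm.0ᴹ-homo (T w)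
      ; +ᴹ-closed = λ p q w → trans (LinearForm.+ᴹ-homo (T w) _ _)
                                (trans (+-cong (p w) (q w)) (+-identityˡ 0#))
      ; *ₗ-closed = λ c p w → trans (LinearForm.*ₗ-homo (T w) c _) (trans (*-congˡ (p w)) (zeroʳ c))
      }

    DegeneratesAt : Family → ∀ j → V.Carrierᴹ j → Set
    DegeneratesAt T j v = ∃ λ z → ¬ Member (kernel T) z × Member (kernel (plug T j v)) z

    Degenerate : Family → Fin m → Set
    Degenerate T j = ∀ v → DegeneratesAt T j v

    update-≈ : ∀ (w : Arguments) j {u v} → V._≈ᴹ_ j u v → ∀ i → V._≈ᴹ_ i (update w j u i) (update w j v i)
    update-≈ w j u≈v i with i Finₚ.≟ j
    ... | yes ≡.refl = u≈v
    ... | no  _      = V.≈ᴹ-refl i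

    update-congˡ : ∀ {w w′ : Arguments} j v → (∀ i → V._≈ᴹ_ i (w i) (w′ i)) →
                   ∀ i → V._≈ᴹ_ i (update w j v i) (update w′ j v i)
    update-congˡ j v w≈w′ i with i Finₚ.≟ j
    ... | yes ≡.refl = V.≈ᴹ-refl i
    ... | no  _      = w≈w′ i

    module _ {T : Family} (T-cong : Congruent T) where
      plug-congruent : ∀ j v → Congruent (plug T j v)
      plug-congruent j v w≈w′ = T-cong (update-congˡ j v w≈w′)

      ≡-cong : ∀ {w w′} → (∀ i → w i ≡ w′ i) → ∀ z → apply (T w) z ≈ apply (T w′) z
      ≡-cong w≡w′ = T-cong λ i → V.≈ᴹ-reflexive i (w≡w′ i)

      plug-comm : ∀ {i j} → i ≢ j → ∀ u v w z →
                  apply (plug (plug T j v) i u w) z ≈ apply (plug (plug T i u) j v w) z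
      plug-comm i≢j u v w = ≡-cong (update-comm w u v i≢j)

      plug-linear : ∀ {i j} → i ≢ j → ∀ v → LinearAt T i → LinearAt (plug T j v) i
      plug-linear {i} {j} i≢j v T-linear = record
        { additive    = λ w u u′ z → trans (plug-comm i≢j (V._+ᴹ_ i u u′) v w z)
            (trans (additive (update w j v) u u′ z)
              (sym (+-cong (plug-comm i≢j u v w z) (plug-comm i≢j u′ v w z))))
        ; homogeneous = λ w s u z → trans (plug-comm i≢j (V._*ₗ_ i s u) v w z)
            (trans (homogeneous (update w j v) s u z) (sym (*-congˡ (plug-comm i≢j u v w z))))
        }
        where open LinearAt T-linear

      degenerates-cong : ∀ {j u v} → V._≈ᴹ_ j u v → DegeneratesAt T j u → DegeneratesAt T j v
      degenerates-cong {j} u≈v (z , z∉ , z∈) =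
        z , z∉ , λ w → trans (T-cong (update-≈ w j (V.≈ᴹ-sym j u≈v)) z) (z∈ w)

      -- By linearity, T at u + t d is the pencil of `plug T j u` and `plug T j d`. One more
      -- degenerate parameter than the rank bound yields a relation modulo `kernel T`, and
      -- `pencil-kernel` carries it to any t.
      degenerates-along-line : ∀ {j n} → LinearAt T j → CodimAtMost (kernel T) n → ∀ u d →
        Frequently (λ k → DegeneratesAt T j (V._+ᴹ_ j u (V._*ₗ_ j (ι k) d))) →
        ∀ t → DegeneratesAt T j (V._+ᴹ_ j u (V._*ₗ_ j t d))
      degenerates-along-line {j} {n} T-linear codim u d frequent t
        with frequently⇒increasing frequent (suc n) 0
      ... | f , _ , f-inj , at with codim (λ i → proj₁ (at i))
      ...   | c , nt , cx∈N
        with pencil-kernel (plug T j u) (plug T j d) (kernel T) (λ z∈ w → z∈ (update w j d))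
               (λ i → proj₁ (at i)) (ι ∘ f) (f-inj ∘ ι-injective) (λ i → proj₁ (proj₂ (at i)))
               (λ i w → trans (sym (affine-combination w u (ι (f i)) d _)) (proj₂ (proj₂ (at i)) w))
               c nt cx∈N t
        where open LinearAt T-linear
      ...     | z , z∉ , z∈ = z , z∉ , λ w → trans (affine-combination w u t d z) (z∈ w)
        where open LinearAt T-linear

      -- With the other slots fixed, `F` is linear on a plane and vanishes at the independent
      -- vectors u and v; Cramer's rule gives its vanishing on the basis.
      kernel-of-independent : ∀ {j} → LinearAt T j → ∀ {u v} → apply (Plane.det (planes j) u) v ≉ 0# →
        ∀ {z} → Member (kernel (plug T j u)) z → Member (kernel (plug T j v)) z → Member (kernel T) z
      kernel-of-independent {j} T-linear {u} {v} det≉0 {z} z∈u z∈v w = begin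
        apply (T w) z
          ≈⟨ ≡-cong (λ i → ≡.sym (update-self w j i)) z ⟩
        F (w j)
          ≈⟨ F-expand (w j) ⟩
        apply x₀ (w j) * F b₀ + apply x₁ (w j) * F b₁
          ≈⟨ +-cong (*-congˡ Fb₀≈0) (*-congˡ Fb₁≈0) ⟩
        apply x₀ (w j) * 0# + apply x₁ (w j) * 0#
          ≈⟨ solve 2 (λ a b → a :* con (+ 0) :+ b :* con (+ 0) := con (+ 0)) refl _ _ ⟩
        0# ∎
        where
        open SetoidReasoning setoid
        open Plane (planes j)

        F : V.Carrierᴹ j → Carrier
        F v = apply (plug T j v w) z

        F-expand : ∀ v → F v ≈ apply x₀ v * F b₀ + apply x₁ v * F b₁
        F-expand v = trans (T-cong (update-≈ w j (expand v)) z)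
          (LinearAt.linear-combination T-linear w _ b₀ _ b₁ z)

        Fu≈0 : apply x₀ u * F b₀ + apply x₁ u * F b₁ ≈ 0#
        Fu≈0 = trans (sym (F-expand u)) (z∈u w)

        Fv≈0 : apply x₀ v * F b₀ + apply x₁ v * F b₁ ≈ 0#
        Fv≈0 = trans (sym (F-expand v)) (z∈v w)

        Fb₀≈0 : F b₀ ≈ 0#
        Fb₀≈0 = *-cancel-0 det≉0 (begin
          apply (det u) v * F b₀
            ≈⟨ solve 6 (λ u₀ u₁ v₀ v₁ f₀ f₁ → (u₀ :* v₁ :+ :- u₁ :* v₀) :* f₀
                 := v₁ :* (u₀ :* f₀ :+ u₁ :* f₁) :- u₁ :* (v₀ :* f₀ :+ v₁ :* f₁))
                 refl (apply x₀ u) (apply x₁ u) (apply x₀ v) (apply x₁ v) (F b₀) (F b₁) ⟩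
          apply x₁ v * (apply x₀ u * F b₀ + apply x₁ u * F b₁)
            - apply x₁ u * (apply x₀ v * F b₀ + apply x₁ v * F b₁)
            ≈⟨ +-cong (*-congˡ Fu≈0) (-‿cong (*-congˡ Fv≈0)) ⟩
          apply x₁ v * 0# - apply x₁ u * 0#
            ≈⟨ solve 2 (λ a b → a :* con (+ 0) :- b :* con (+ 0) := con (+ 0)) refl _ _ ⟩
          0# ∎)

        Fb₁≈0 : F b₁ ≈ 0#
        Fb₁≈0 = *-cancel-0 det≉0 (begin
          apply (det u) v * F b₁
            ≈⟨ solve 6 (λ u₀ u₁ v₀ v₁ f₀ f₁ → (u₀ :* v₁ :+ :- u₁ :* v₀) :* f₁
                 := u₀ :* (v₀ :* f₀ :+ v₁ :* f₁) :- v₀ :* (u₀ :* f₀ :+ u₁ :* f₁))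
                 refl (apply x₀ u) (apply x₁ u) (apply x₀ v) (apply x₁ v) (F b₀) (F b₁) ⟩
          apply x₀ u * (apply x₀ v * F b₀ + apply x₁ v * F b₁)
            - apply x₀ v * (apply x₀ u * F b₀ + apply x₁ u * F b₁)
            ≈⟨ +-cong (*-congˡ Fv≈0) (-‿cong (*-congˡ Fu≈0)) ⟩
          apply x₀ u * 0# - apply x₀ v * 0#
            ≈⟨ solve 2 (λ a b → a :* con (+ 0) :- b :* con (+ 0) := con (+ 0)) refl _ _ ⟩
          0# ∎)

    -- The line from `v` to an arbitrary `y` leaves the zero set of p at `v`, hence at almost all of
    -- its points. Degeneracy there spreads to the parameter 1, which is `y`.
    degenerate-everywhere : ∀ {T j n d} → Congruent T → LinearAt T j → CodimAtMost (kernel T) n →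
      (p : Homogeneous (V j) d) → (∃ λ v → evaluate (V j) p v ≉ 0#) →
      (∀ v → evaluate (V j) p v ≉ 0# → DegeneratesAt T j v) → Degenerate T j
    degenerate-everywhere {T} {j} T-cong linear codim p (v , pv≉0) at-nonzero y =
      degenerates-cong {T} T-cong (line-at-1 {V j} v y)
        (degenerates-along-line {T} T-cong linear codim v d
          (eventually⇒frequently (eventually-map (λ k → at-nonzero _)
            (evaluate-eventually-nonzero p v d 0#
              λ ≈0 → pv≉0 (trans (evaluate-cong p (V.≈ᴹ-sym j (line-at-0 {V j} v d))) ≈0))))
          1#)
      where d = V._+ᴹ_ j y (V.-ᴹ_ j v)

    -- If T(u, ·) and T(v, ·) are non-degenerate at y and y′ respectively, then both
    -- are so at almost all points of the line through y and y′.  At such a point, the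
    -- element of the kernel provided by the degeneracy of T lies in the kernels of
    -- T(u, ·) and T(v, ·).
    degenerate-of-independent : ∀ {T i j n} → Congruent T → i ≢ j → LinearAt T i → LinearAt T j →
      CodimAtMost (kernel T) n → Degenerate T i → ∀ {u v} → apply (Plane.det (planes j) u) v ≉ 0# →
      ¬ Degenerate (plug T j u) i → Degenerate (plug T j v) i
    degenerate-of-independent {T} {i} {j} T-cong i≢j linear-i linear-j codim degenerate {u} {v}
      det≉0 ¬degenerate-u =
      dne λ ¬degenerate-v → impossible (¬∀⇒∃¬ ¬degenerate-u) (¬∀⇒∃¬ ¬degenerate-v)
      where
      impossible : (∃ λ y → ¬ DegeneratesAt (plug T j u) i y) →
                   (∃ λ y → ¬ DegeneratesAt (plug T j v) i y) → ⊥
      impossible (y , ¬y) (y′ , ¬y′) = z∉ (kernel-of-independent {T} T-cong linear-j det≉0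
        (in-kernel u (proj₁ (proj₂ generic))) (in-kernel v (proj₂ (proj₂ generic))))
        where
        point : Carrier → V.Carrierᴹ i
        point t = V._+ᴹ_ i y (V._*ₗ_ i t (V._+ᴹ_ i y′ (V.-ᴹ_ i y)))

        rarely-degenerates : ∀ x t → ¬ DegeneratesAt (plug T j x) i (point t) →
                             Eventually λ k → ¬ DegeneratesAt (plug T j x) i (point (ι k))
        rarely-degenerates x t ¬t = ¬frequently⇒eventually¬ λ frequent → ¬t
          (degenerates-along-line (plug-congruent {T} T-cong j x) (plug-linear {T} T-cong i≢j x linear-i)
            (codim-antitone {N = kernel T} {N′ = kernel (plug T j x)} (λ z∈ w → z∈ (update w j x)) codim)
            y _ frequent t)

        generic : ∃ λ k → ¬ DegeneratesAt (plug T j u) i (point (ι k)) ×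
                          ¬ DegeneratesAt (plug T j v) i (point (ι k))
        generic = eventually-inhabited (eventually-∧
          (rarely-degenerates u 0#
            (¬y ∘ degenerates-cong {plug T j u} (plug-congruent {T} T-cong j u) (line-at-0 {V i} y _)))
          (rarely-degenerates v 1#
            (¬y′ ∘ degenerates-cong {plug T j v} (plug-congruent {T} T-cong j v) (line-at-1 {V i} y y′))))

        y″ : V.Carrierᴹ i
        y″ = point (ι (proj₁ generic))

        z : H.Carrierᴹ
        z = proj₁ (degenerate y″)

        z∉ : ¬ Member (kernel T) z
        z∉ = proj₁ (proj₂ (degenerate y″))

        in-kernel : ∀ x → ¬ DegeneratesAt (plug T j x) i y″ → Member (kernel (plug T j x)) z
        -- `z` is annihilated with `y″` in slot i, so outside `kernel (plug T j x)` it would witness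
        -- degeneracy of `plug T j x` at `y″`.
        in-kernel x ¬x = dne λ z∉x → ¬x (z , z∉x , λ w →
          trans (plug-comm {T} T-cong i≢j y″ x w z) (proj₂ (proj₂ (degenerate y″)) (update w j x)))

    -- If some nonzero u is bad, every v independent of u is good, and the condition is `det u` ≠ 0.
    -- If none is bad, it remains to exclude v = 0, for which a coordinate suffices.
    degenerate-generic : ∀ {T i j n} → Congruent T → i ≢ j → LinearAt T i → LinearAt T j →
      CodimAtMost (kernel T) n → Degenerate T i →
      Σ[ α ∈ LinearForm (V j) ] (∃ λ v → apply α v ≉ 0#) ×
        (∀ v → apply α v ≉ 0# → Degenerate (plug T j v) i)
    degenerate-generic {T} {i} {j} T-cong i≢j linear-i linear-j codim degenerate
      with em {P = ∃ λ u → ¬ V._≈ᴹ_ j u (V.0ᴹ j) × ¬ Degenerate (plug T j u) i}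
    ... | yes (u , u≉0 , ¬degenerate-u) = P.det u , P.det-nonzero u u≉0 , λ v det≉0 →
          degenerate-of-independent T-cong i≢j linear-i linear-j codim degenerate det≉0 ¬degenerate-u
      where module P = Plane (planes j)
    ... | no all-degenerate = P.x₀ , (P.b₀ , P.x₀b₀≉0) , λ v x₀v≉0 →
          dne λ ¬degenerate-v → all-degenerate (v , x₀v≉0 ∘ P.x₀-zero , ¬degenerate-v)
      where module P = Plane (planes j)

    all-degenerate-generic : ∀ {T j n} → Congruent T → LinearAt T j → CodimAtMost (kernel T) n →
      ∀ is → All (j ≢_) is → All (LinearAt T) is → All (Degenerate T) is →
      Σ[ d ∈ ℕ ] Σ[ p ∈ Homogeneous (V j) d ] (∃ λ v → evaluate (V j) p v ≉ 0#) ×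
        (∀ v → evaluate (V j) p v ≉ 0# →
           ¬ V._≈ᴹ_ j v (V.0ᴹ j) × All (Degenerate (plug T j v)) is)
    all-degenerate-generic {j = j} T-cong linear-j codim [] [] [] [] =
      -- With no slot left to care for, the factor `x₀` serves to keep v away from 0.
      1 , form x₀ , (b₀ , x₀b₀≉0) , λ v x₀v≉0 → x₀v≉0 ∘ x₀-zero , []
      where open Plane (planes j)
    all-degenerate-generic {T} {j} T-cong linear-j codim (i ∷ is) (j≢i ∷ j≢is) (linear-i ∷ linear)
        (degenerate-i ∷ degenerate)
      with degenerate-generic T-cong (j≢i ∘ ≡.sym) linear-i linear-j codim degenerate-i
         | all-degenerate-generic T-cong linear-j codim is j≢is linear degenerate
    ... | α , (u , αu≉0) , α-good | d , p , (v , pv≉0) , p-good =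
      suc d , form α ⊠ p , (_ , proj₂ (common-nonzero (form α) p u v αu≉0 pv≉0)) , λ w ≉0 →
        let w≉0 , good = p-good w (λ p≈0 → ≉0 (trans (*-congˡ p≈0) (zeroʳ _)))
        in w≉0 , α-good w (λ α≈0 → ≉0 (trans (*-congʳ α≈0) (zeroˡ _))) ∷ good

    codim-plug : ∀ {T j n} v → DegeneratesAt T j v →
                 CodimAtMost (kernel T) (suc n) → CodimAtMost (kernel (plug T j v)) n
    codim-plug {T} {j} v (z , z∉ , z∈) =
      codim-drop (kernel T) (kernel (plug T j v)) (λ z∈ w → z∈ (update w j v)) z∉ z∈

    -- Induction on the slots: a generic v in slot j keeps the other slots degenerate and costs at
    -- least one in rank, because T degenerates at v.
    codim-lower-bound : ∀ {T} → Congruent T → ∀ j js → Unique (j ∷ js) →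
      All (LinearAt T) (j ∷ js) → All (Degenerate T) (j ∷ js) →
      ¬ CodimAtMost (kernel T) (length (j ∷ js))
    codim-lower-bound {T} T-cong j [] _ _ (degenerate ∷ []) codim =
      -- The vector 0 is an arbitrary choice; only some z outside `kernel T` is wanted.
      let z , z∉ , _       = degenerate (V.0ᴹ j)
          w , Tz≉0         = ¬∀⇒∃¬ z∉
          -- `plug T j (w j)` has rank 0, so even the single element z is dependent modulo its
          -- kernel, and T vanishes at w and z after all.
          c , (i , c≉0) , cz∈ = codim-plug {T} (w j) (degenerate (w j)) codim (λ _ → z)
          N                = kernel (plug T j (w j))
          z∈               = unscale N {c = c zero} {z} (head-nonzero c i c≉0)
                               (Subspace.≈ᴹ-closed N (H.+ᴹ-identityʳ _) cz∈)
      in Tz≉0 (trans (≡-cong {T} T-cong (λ i → ≡.sym (update-self w j i)) z) (z∈ w))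
      where
      head-nonzero : ∀ (c : Fin 1 → Carrier) i → c i ≉ 0# → c zero ≉ 0#
      head-nonzero c zero c≉0 = c≉0
    codim-lower-bound {T} T-cong j (i ∷ is) (j≢ ∷ unique) (linear-j ∷ linear)
        (degenerate-j ∷ degenerate) codim
      with all-degenerate-generic T-cong linear-j codim (i ∷ is) j≢ linear degenerate
    ... | _ , _ , (v , pv≉0) , good =
      codim-lower-bound (plug-congruent {T} T-cong j v) i is unique (plug-all j≢ linear)
        (proj₂ (good v pv≉0)) (codim-plug {T} v (degenerate-j v) codim)
      where
      plug-all : ∀ {is} → All (j ≢_) is → All (LinearAt T) is → All (LinearAt (plug T j v)) is
      plug-all []          []              = []
      plug-all (j≢i ∷ j≢s) (linear ∷ rest) =
        plug-linear {T} T-cong (j≢i ∘ ≡.sym) v linear ∷ plug-all j≢s rest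

  -- Tensors as multilinear functions

  open Sum *-commutativeMonoid using () renaming (sum to product; sum-cong-≋ to product-cong)

  product-add : ∀ {n} {f g h : Fin n → Carrier} j →
                (∀ i → i ≢ j → f i ≈ g i) → (∀ i → i ≢ j → f i ≈ h i) →
                f j ≈ g j + h j → product f ≈ product g + product h
  product-add zero f≈g f≈h f₀≈ = trans (*-congʳ f₀≈) (trans (distribʳ _ _ _)
    (+-cong (*-congˡ (product-cong λ i → f≈g (suc i) λ ())) (*-congˡ (product-cong λ i → f≈h (suc i) λ ()))))
  product-add (suc j) f≈g f≈h fⱼ≈ = trans
    (*-congˡ (product-add j (λ i i≢j → f≈g (suc i) (i≢j ∘ Finₚ.suc-injective))
                            (λ i i≢j → f≈h (suc i) (i≢j ∘ Finₚ.suc-injective)) fⱼ≈))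
    (trans (distribˡ _ _ _) (+-cong (*-congʳ (f≈g zero λ ())) (*-congʳ (f≈h zero λ ()))))

  product-scale : ∀ {n} {f g : Fin n → Carrier} j c → (∀ i → i ≢ j → f i ≈ g i) →
                  f j ≈ c * g j → product f ≈ c * product g
  product-scale zero c f≈g f₀≈ = trans
    (*-cong f₀≈ (product-cong λ i → f≈g (suc i) λ ())) (*-assoc _ _ _)
  product-scale (suc j) c f≈g fⱼ≈ = trans
    (*-cong (f≈g zero λ ()) (product-scale j c (λ i i≢j → f≈g (suc i) (i≢j ∘ Finₚ.suc-injective)) fⱼ≈))
    (solve 3 (λ a c p → a :* (c :* p) := c :* (a :* p)) refl _ c _)

  product-1 : ∀ {n} {f : Fin n → Carrier} → (∀ i → f i ≈ 1#) → product f ≈ 1#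
  product-1 {zero}  f≈1 = refl
  product-1 {suc n} f≈1 = trans (*-cong (f≈1 zero) (product-1 (f≈1 ∘ suc))) (*-identityˡ 1#)

  -- Evaluation of tensors and its injectivity

  module _ {m : ℕ} (V : Fin m → VectorSpace) where
    private
      module V j = LeftModule (V j)

      W : Fin m → VectorSpace
      W j = Dual (V j)

      module W j = LeftModule (W j)

      Args : Set
      Args = ∀ j → V.Carrierᴹ j

    multilinear : Tensor W → Args → Carrier
    multilinear (pure α) w = product λ i → apply (α i) (w i)
    multilinear (s ⊕ t)  w = multilinear s w + multilinear t w
    multilinear (c ⊙ t)  w = c * multilinear t w
    multilinear 𝟎        w = 0#
    multilinear (⊖ t)    w = - multilinear t w

    multilinear-cong : ∀ {s t} → _≋_ W s t → ∀ w → multilinear s w ≈ multilinear t w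
    multilinear-cong ≋-refl              w = refl
    multilinear-cong (≋-sym p)           w = sym (multilinear-cong p w)
    multilinear-cong (≋-trans p q)       w = trans (multilinear-cong p w) (multilinear-cong q w)
    multilinear-cong (pure-cong p)       w = product-cong λ i → p i (w i)
    multilinear-cong (⊕-cong p q)        w = +-cong (multilinear-cong p w) (multilinear-cong q w)
    multilinear-cong (⊙-cong p q)        w = *-cong p (multilinear-cong q w)
    multilinear-cong (⊖-cong p)          w = -‿cong (multilinear-cong p w)
    multilinear-cong (⊕-assoc _ _ _)     w = +-assoc _ _ _
    multilinear-cong (⊕-comm _ _)        w = +-comm _ _
    multilinear-cong (⊕-identityˡ _)     w = +-identityˡ _
    multilinear-cong (⊖-inverseˡ _)      w = -‿inverseˡ _
    multilinear-cong (⊙-distribˡ _ _ _)  w = distribˡ _ _ _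
    multilinear-cong (⊙-distribʳ _ _ _)  w = distribʳ _ _ _
    multilinear-cong (⊙-assoc _ _ _)     w = *-assoc _ _ _
    multilinear-cong (⊙-identityˡ _)     w = *-identityˡ _
    multilinear-cong (⊙-zeroˡ _)         w = zeroˡ _
    multilinear-cong (⊙-zeroʳ _)         w = zeroʳ _
    multilinear-cong (pure-+ j p q r)    w =
      product-add j (λ i i≢j → p i i≢j (w i)) (λ i i≢j → q i i≢j (w i)) (r (w j))
    multilinear-cong (pure-* j c p q)    w =
      product-scale j c (λ i i≢j → p i i≢j (w i)) (q (w j))

    multilinear-argument-cong : ∀ t {w w′} → (∀ i → V._≈ᴹ_ i (w i) (w′ i)) →
                                multilinear t w ≈ multilinear t w′
    multilinear-argument-cong (pure α) p = product-cong λ i → LinearForm.⟦⟧-cong (α i) (p i)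
    multilinear-argument-cong (s ⊕ t)  p =
      +-cong (multilinear-argument-cong s p) (multilinear-argument-cong t p)
    multilinear-argument-cong (c ⊙ t)  p = *-congˡ (multilinear-argument-cong t p)
    multilinear-argument-cong 𝟎        p = refl
    multilinear-argument-cong (⊖ t)    p = -‿cong (multilinear-argument-cong t p)

    private
      apply-other : ∀ (α : ∀ i → LinearForm (V i)) w {j} u v i → i ≢ j →
                    apply (α i) (update w j u i) ≈ apply (α i) (update w j v i)
      apply-other α w u v i i≢j = reflexive
        (≡.cong (apply (α i)) (≡.trans (update-other w u i≢j) (≡.sym (update-other w v i≢j))))

      apply-same : ∀ (α : ∀ i → LinearForm (V i)) w j v →
                   apply (α j) (update w j v j) ≈ apply (α j) v
      apply-same α w j v = reflexive (≡.cong (apply (α j)) (update-same w j v))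

    multilinear-additive : ∀ t w j u v →
      multilinear t (update w j (V._+ᴹ_ j u v)) ≈ multilinear t (update w j u) + multilinear t (update w j v)
    multilinear-additive (pure α) w j u v = product-add j
      (apply-other α w _ u) (apply-other α w _ v)
      (trans (apply-same α w j _) (trans (LinearForm.+ᴹ-homo (α j) u v)
        (sym (+-cong (apply-same α w j u) (apply-same α w j v)))))
    multilinear-additive (s ⊕ t)  w j u v = trans
      (+-cong (multilinear-additive s w j u v) (multilinear-additive t w j u v))
      (solve 4 (λ a b c d → (a :+ b) :+ (c :+ d) := (a :+ c) :+ (b :+ d)) refl _ _ _ _)
    multilinear-additive (c ⊙ t)  w j u v = trans (*-congˡ (multilinear-additive t w j u v)) (distribˡ c _ _)
    multilinear-additive 𝟎        w j u v = sym (+-identityˡ 0#)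
    multilinear-additive (⊖ t)    w j u v = trans (-‿cong (multilinear-additive t w j u v))
      (solve 2 (λ a b → :- (a :+ b) := :- a :+ :- b) refl _ _)

    multilinear-homogeneous : ∀ t w j c v →
      multilinear t (update w j (V._*ₗ_ j c v)) ≈ c * multilinear t (update w j v)
    multilinear-homogeneous (pure α) w j c v = product-scale j c (apply-other α w _ v)
      (trans (apply-same α w j _) (trans (LinearForm.*ₗ-homo (α j) c v) (sym (*-congˡ (apply-same α w j v)))))
    multilinear-homogeneous (s ⊕ t)  w j c v = trans
      (+-cong (multilinear-homogeneous s w j c v) (multilinear-homogeneous t w j c v))
      (sym (distribˡ c _ _))
    multilinear-homogeneous (a ⊙ t)  w j c v = trans (*-congˡ (multilinear-homogeneous t w j c v))
      (solve 3 (λ a c x → a :* (c :* x) := c :* (a :* x)) refl a c _)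
    multilinear-homogeneous 𝟎        w j c v = sym (zeroʳ c)
    multilinear-homogeneous (⊖ t)    w j c v = trans (-‿cong (multilinear-homogeneous t w j c v))
      (solve 2 (λ c x → :- (c :* x) := c :* :- x) refl c _)

    multilinear-Σ⁰ : ∀ j ℓ {t} → Member (Σ⁰ V j ℓ) t → ∀ {v} → Member (line ℓ) v →
                     ∀ w → multilinear t (update w j v) ≈ 0#
    multilinear-Σ⁰ j ℓ (generator (α , α∈ℓ⁰ , α≋t)) {v} v∈ℓ w = trans (sym (multilinear-cong α≋t _))
      -- A product with a zero factor: `f` is compared with itself, with the scalar 0 in slot j.
      (trans (product-scale {f = f} {g = f} j 0# (λ _ _ → refl)
               (trans (trans (apply-same α w j v) (α∈ℓ⁰ v v∈ℓ)) (sym (zeroˡ _))))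
             (zeroˡ _))
      where f = λ i → apply (α i) (update w j v i)
    multilinear-Σ⁰ j ℓ (≈ᴹ-closed s≋t s∈) v∈ℓ w =
      trans (sym (multilinear-cong s≋t _)) (multilinear-Σ⁰ j ℓ s∈ v∈ℓ w)
    multilinear-Σ⁰ j ℓ 0ᴹ-closed          v∈ℓ w = refl
    multilinear-Σ⁰ j ℓ (+ᴹ-closed s∈ t∈)  v∈ℓ w = trans
      (+-cong (multilinear-Σ⁰ j ℓ s∈ v∈ℓ w) (multilinear-Σ⁰ j ℓ t∈ v∈ℓ w)) (+-identityˡ 0#)
    multilinear-Σ⁰ j ℓ (*ₗ-closed c t∈)   v∈ℓ w = trans (*-congˡ (multilinear-Σ⁰ j ℓ t∈ v∈ℓ w)) (zeroʳ c)

    module _ (planes : ∀ j → Plane (V j)) where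
      private module P j = Plane (planes j)

      -- Σ F(w′) ⊙ pure e′ over all pairs (w′ , e′) obtained from (w , e) by
      -- replacing each (w j , e j) with j ∈ js by (b₀ , x₀) or (b₁ , x₁).
      expansionAlong : List (Fin m) → (Args → Carrier) → Args → (∀ i → LinearForm (V i)) → Tensor W
      expansionAlong []       F w e = F w ⊙ pure e
      expansionAlong (j ∷ js) F w e =
        expansionAlong js F (update w j (P.b₀ j)) (update e j (P.x₀ j)) ⊕
        expansionAlong js F (update w j (P.b₁ j)) (update e j (P.x₁ j))

      expansionAlong-0 : ∀ js {F} → (∀ w → F w ≈ 0#) → ∀ w e → _≋_ W (expansionAlong js F w e) 𝟎
      expansionAlong-0 []       F≈0 w e = ≋-trans (⊙-cong (F≈0 w) ≋-refl) (⊙-zeroˡ _)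
      expansionAlong-0 (j ∷ js) F≈0 w e = ≋-trans
        (⊕-cong (expansionAlong-0 js F≈0 _ _) (expansionAlong-0 js F≈0 _ _)) (⊕-identityˡ 𝟎)

      open CommutativeSemigroupProperties
        (CommutativeMonoid.commutativeSemigroup (LeftModule.+ᴹ-commutativeMonoid (⨂ W))) using (interchange)

      expansionAlong-+ : ∀ js F G w e → _≋_ W (expansionAlong js (λ w → F w + G w) w e)
                                              (expansionAlong js F w e ⊕ expansionAlong js G w e)
      expansionAlong-+ []       F G w e = ⊙-distribʳ (pure e) (F w) (G w)
      expansionAlong-+ (j ∷ js) F G w e = ≋-trans
        (⊕-cong (expansionAlong-+ js F G _ _) (expansionAlong-+ js F G _ _)) (interchange _ _ _ _)

      -- The proportionality is demanded only at tuples that agree with w outside js. This locality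
      -- lets a scalar come out that depends on a slot already replaced.
      expansionAlong-* : ∀ js c {F G} w e →
        (∀ w′ → (∀ i → All (i ≢_) js → w′ i ≡ w i) → F w′ ≈ c * G w′) →
        _≋_ W (expansionAlong js F w e) (c ⊙ expansionAlong js G w e)
      expansionAlong-* [] c w e F≈cG = ≋-trans (⊙-cong (F≈cG w λ _ _ → ≡.refl) ≋-refl) (⊙-assoc c _ _)
      expansionAlong-* (j ∷ js) c {F} {G} w e F≈cG = ≋-trans
        (⊕-cong (half (P.b₀ j) (P.x₀ j)) (half (P.b₁ j) (P.x₁ j))) (≋-sym (⊙-distribˡ c _ _))
        where
        half : ∀ b x → _≋_ W (expansionAlong js F (update w j b) (update e j x))
                             (c ⊙ expansionAlong js G (update w j b) (update e j x))
        half b x = expansionAlong-* js c (update w j b) (update e j x) λ w′ w′≡ →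
          F≈cG w′ λ { i (i≢j ∷ i≢js) → ≡.trans (w′≡ i i≢js) (update-other w b i≢j) }

      pure-expand : ∀ α j → _≋_ W (pure α)
        ((apply (α j) (P.b₀ j) ⊙ pure (update α j (P.x₀ j))) ⊕
         (apply (α j) (P.b₁ j) ⊙ pure (update α j (P.x₁ j))))
      pure-expand α j = ≋-trans
        (pure-+ j {v = update α j (W._*ₗ_ j (apply (α j) (P.b₀ j)) (P.x₀ j))}
                  {w = update α j (W._*ₗ_ j (apply (α j) (P.b₁ j)) (P.x₁ j))}
          (λ i i≢j → W.≈ᴹ-reflexive i (≡.sym (update-other α _ i≢j)))
          (λ i i≢j → W.≈ᴹ-reflexive i (≡.sym (update-other α _ i≢j)))
          (λ v → trans (coordinates v) (sym (+-cong (at-j _ v) (at-j _ v)))))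
        (⊕-cong (scale (P.b₀ j) (P.x₀ j)) (scale (P.b₁ j) (P.x₁ j)))
        where
        at-j : ∀ β v → apply (update α j β j) v ≈ apply β v
        at-j β v = reflexive (≡.cong (λ γ → apply γ v) (update-same α j β))

        coordinates : W._≈ᴹ_ j (α j) (W._+ᴹ_ j (W._*ₗ_ j (apply (α j) (P.b₀ j)) (P.x₀ j))
                                               (W._*ₗ_ j (apply (α j) (P.b₁ j)) (P.x₁ j)))
        coordinates v = trans (αⱼ.⟦⟧-cong (P.expand j v)) (trans (αⱼ.+ᴹ-homo _ _)
          (+-cong (trans (αⱼ.*ₗ-homo _ _) (*-comm _ _)) (trans (αⱼ.*ₗ-homo _ _) (*-comm _ _))))
          where module αⱼ = LinearForm (α j)

        scale : ∀ b x → _≋_ W (pure (update α j (W._*ₗ_ j (apply (α j) b) x)))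
                              (apply (α j) b ⊙ pure (update α j x))
        scale b x = pure-* j (apply (α j) b)
          (λ i i≢j v → reflexive (≡.cong (λ γ → apply γ v)
            (≡.trans (update-other α _ i≢j) (≡.sym (update-other α x i≢j)))))
          (λ v → trans (at-j _ v) (*-congˡ (sym (at-j x v))))

      -- The hypothesis describes the slots already treated. Treating j splits α j as α j (b₀) x₀ +
      -- α j (b₁) x₁; in each half the scalar comes out and α j becomes x₀ or x₁, so that j meets
      -- the hypothesis too.
      expansionAlong-pure : ∀ js → Unique js → ∀ α w e →
        (∀ i → All (i ≢_) js → W._≈ᴹ_ i (e i) (α i) × apply (α i) (w i) ≈ 1#) →
        _≋_ W (expansionAlong js (multilinear (pure α)) w e) (pure α)
      expansionAlong-pure [] [] α w e done = ≋-trans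
        (⊙-cong (product-1 λ i → proj₂ (done i [])) (pure-cong λ i → proj₁ (done i []))) (⊙-identityˡ _)
      expansionAlong-pure (j ∷ js) (j≢js ∷ unique) α w e done = ≋-trans
        (⊕-cong (half (P.b₀ j) (P.x₀ j) (P.x₀b₀≈1 j)) (half (P.b₁ j) (P.x₁ j) (P.x₁b₁≈1 j)))
        (≋-sym (pure-expand α j))
        where
        half : ∀ b x → apply x b ≈ 1# →
               _≋_ W (expansionAlong js (multilinear (pure α)) (update w j b) (update e j x))
                     (apply (α j) b ⊙ pure (update α j x))
        half b x xb≈1 = ≋-trans
          (expansionAlong-* js (apply (α j) b) (update w j b) (update e j x) λ w′ w′≡ →
            product-scale j (apply (α j) b)
              (λ i i≢j → reflexive (≡.cong (λ β → apply β (w′ i)) (≡.sym (update-other α x i≢j))))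
              (w′-at-j w′ (≡.trans (w′≡ j j≢js) (update-same w j b))))
          (⊙-cong refl (expansionAlong-pure js unique (update α j x) (update w j b) (update e j x) done′))
          where
          w′-at-j : ∀ (w′ : Args) → w′ j ≡ b →
                    apply (α j) (w′ j) ≈ apply (α j) b * apply (update α j x j) (w′ j)
          w′-at-j w′ w′j≡b rewrite w′j≡b | update-same α j x =
            trans (sym (*-identityʳ _)) (*-congˡ (sym xb≈1))

          done′ : ∀ i → All (i ≢_) js →
                  W._≈ᴹ_ i (update e j x i) (update α j x i) × apply (update α j x i) (update w j b i) ≈ 1#
          done′ i i≢js with i Finₚ.≟ j
          ... | yes ≡.refl = (λ _ → refl) , xb≈1
          ... | no  i≢j    = done i (i≢j ∷ i≢js)

      -- A tensor is recovered from its values at tuples of basis vectors. The initial `w` and `e`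
      -- are arbitrary, since every slot is overwritten.
      expansion-of-tensor : ∀ t w e → _≋_ W (expansionAlong (allFin m) (multilinear t) w e) t
      expansion-of-tensor (pure α) w e = expansionAlong-pure (allFin m) (allFin⁺ m) α w e λ i i≢all →
        contradiction ≡.refl (All.lookup i≢all (∈-allFin i))
      expansion-of-tensor (s ⊕ t)  w e = ≋-trans
        (expansionAlong-+ (allFin m) (multilinear s) (multilinear t) w e)
        (⊕-cong (expansion-of-tensor s w e) (expansion-of-tensor t w e))
      expansion-of-tensor (c ⊙ t)  w e = ≋-trans
        (expansionAlong-* (allFin m) c w e λ _ _ → refl) (⊙-cong refl (expansion-of-tensor t w e))
      expansion-of-tensor 𝟎        w e = expansionAlong-0 (allFin m) (λ _ → refl) w e
      expansion-of-tensor (⊖ t)    w e = ≋-trans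
        (expansionAlong-* (allFin m) (- 1#) w e λ w′ _ →
          trans (-‿cong (sym (*-identityˡ _))) (-‿distribˡ-* 1# (multilinear t w′)))
        (≋-trans (⊙-cong refl (expansion-of-tensor t w e))
          (inverseˡ-unique _ _ (≋-trans (⊕-cong ≋-refl (≋-sym (⊙-identityˡ t)))
            (≋-trans (≋-sym (⊙-distribʳ t (- 1#) 1#)) (≋-trans (⊙-cong (-‿inverseˡ 1#) ≋-refl) (⊙-zeroˡ t))))))
        where
        open RingProperties ring using (-‿distribˡ-*)
        open AbelianGroupProperties (LeftModule.+ᴹ-abelianGroup (⨂ W)) using (inverseˡ-unique)

      multilinear-injective : ∀ t → (∀ w → multilinear t w ≈ 0#) → _≋_ W t 𝟎
      multilinear-injective t t≈0 = ≋-trans (≋-sym (expansion-of-tensor t P.b₀ P.x₀))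
        (expansionAlong-0 (allFin m) t≈0 P.b₀ P.x₀)

  -- Points of the projective line and generic conditions

  module _ {V : VectorSpace} where
    open LeftModule V

    point : ∀ v → ¬ v ≈ᴹ 0ᴹ → ℙ V
    point v v≉0 = record
      { line = record
        { Member    = λ w → ∃ λ c → w ≈ᴹ c *ₗ v
        ; ≈ᴹ-closed = λ u≈w (c , u≈cv) → c , ≈ᴹ-trans (≈ᴹ-sym u≈w) u≈cv
        ; 0ᴹ-closed = 0# , ≈ᴹ-sym (*ₗ-zeroˡ v)
        ; +ᴹ-closed = λ (c , u≈cv) (d , w≈dv) →
            c + d , ≈ᴹ-trans (+ᴹ-cong u≈cv w≈dv) (≈ᴹ-sym (*ₗ-distribʳ v c d))
        ; *ₗ-closed = λ a (c , u≈cv) → a * c , ≈ᴹ-trans (*ₗ-congˡ u≈cv) (≈ᴹ-sym (*ₗ-assoc a c v))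
        }
      ; dim-1 = (λ _ → v) , record
        { member      = λ _ → 1# , ≈ᴹ-sym (*ₗ-identityˡ v)
        ; independent = λ { c cv≈0 zero →
            dne λ c≉0 → v≉0 (cancel c≉0 (≈ᴹ-trans (≈ᴹ-sym (+ᴹ-identityʳ _)) cv≈0)) }
        ; spanning    = λ w (c , w≈cv) → (λ _ → c) , ≈ᴹ-trans w≈cv (≈ᴹ-sym (+ᴹ-identityʳ _))
        }
      }
      where
      open SetoidReasoning ≈ᴹ-setoid
      cancel : ∀ {c} → c ≉ 0# → c *ₗ v ≈ᴹ 0ᴹ → v ≈ᴹ 0ᴹ
      cancel {c} c≉0 cv≈0 with inverse c c≉0
      ... | c⁻¹ , cc⁻¹≈1 = begin
        v                  ≈⟨ *ₗ-identityˡ v ⟨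
        1# *ₗ v            ≈⟨ *ₗ-congʳ (trans (*-comm c⁻¹ c) cc⁻¹≈1) ⟨
        (c⁻¹ * c) *ₗ v     ≈⟨ *ₗ-assoc c⁻¹ c v ⟩
        c⁻¹ *ₗ (c *ₗ v)    ≈⟨ *ₗ-congˡ cv≈0 ⟩
        c⁻¹ *ₗ 0ᴹ          ≈⟨ *ₗ-zeroʳ c⁻¹ ⟩
        0ᴹ                 ∎

    ∈point : ∀ v v≉0 → Member (line (point v v≉0)) v
    ∈point v v≉0 = 1# , ≈ᴹ-sym (*ₗ-identityˡ v)

    nonvanishing : ∀ {d} (p : Homogeneous V d) ℓ → ¬ VanishesOn V p ℓ →
                   ∃ λ v → Member (line ℓ) v × evaluate V p v ≉ 0#
    nonvanishing p ℓ ¬vanishes with ¬∀⇒∃¬ ¬vanishes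
    ... | v , ¬v = v , dne (λ v∉ℓ → ¬v λ v∈ℓ → contradiction v∈ℓ v∉ℓ) , λ ≈0 → ¬v λ _ → ≈0

    BasicOpen : ∀ {d} → Homogeneous V d → Pred (ℙ V) 0ℓ
    BasicOpen p ℓ = ∃ λ v → Member (line ℓ) v × evaluate V p v ≉ 0#

    -- A point of the open set lies off the closed complement, so one of the defining polynomials
    -- does not vanish on it; the locus where this polynomial is nonzero avoids the complement.
    generic⇒basicOpen : ∀ {P} → ForGeneric V P → Σ[ d ∈ ℕ ] Σ[ p ∈ Homogeneous V d ]
                        (∃ λ v → evaluate V p v ≉ 0#) × (∀ ℓ → BasicOpen p ℓ → P ℓ)
    generic⇒basicOpen (O , (I , d , f , closed) , (ℓ₀ , ℓ₀∈O) , O⇒P)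
      with ¬∀⇒∃¬ (λ vanish → Equivalence.from (closed ℓ₀) vanish ℓ₀∈O)
    ... | i , ¬vanish with nonvanishing (f i) ℓ₀ ¬vanish
    ...   | v , _ , fv≉0 = d i , f i , (v , fv≉0) , λ ℓ (w , w∈ℓ , fw≉0) →
            O⇒P ℓ (dne λ ℓ∉O → fw≉0 (Equivalence.to (closed ℓ) ℓ∉O i w w∈ℓ))

    basicOpen⇒generic : ∀ {P d} (p : Homogeneous V d) v → ¬ v ≈ᴹ 0ᴹ → evaluate V p v ≉ 0# →
                        (∀ ℓ → BasicOpen p ℓ → P ℓ) → ForGeneric V P
    basicOpen⇒generic {d = d} p v v≉0 pv≉0 P-if =
      BasicOpen p ,
      (⊤ , (λ _ → d) , (λ _ → p) , λ ℓ → mk⇔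
        (λ ℓ∉ _ w w∈ℓ → dne λ pw≉0 → ℓ∉ (w , w∈ℓ , pw≉0))
        (λ vanish (w , w∈ℓ , pw≉0) → pw≉0 (vanish _ w w∈ℓ))) ,
      (point v v≉0 , v , ∈point v v≉0 , pv≉0) ,
      P-if

  -- The family of a weak factorization structure

  module _ {m : ℕ} (V : Fin (suc (suc m)) → VectorSpace) (dims : ∀ j → dim whole (V j) ≡ 2)
    (𝔥 : VectorSpace) (φ : LeftModule.Carrierᴹ 𝔥 → LeftModule.Carrierᴹ (V* V))
    (weak : IsWeakFactorizationStructure V 𝔥 φ) where
    private
      module weak = IsWeakFactorizationStructure weak
      module 𝔥 = LeftModule 𝔥
      module V j = LeftModule (V j)
      module Tensors = LeftModule (V* V)

    open LeftModule (V* V) using () renaming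
      (_≈ᴹ_ to _≈ᵗ_; _+ᴹ_ to _+ᵗ_; _*ₗ_ to _*ᵗ_; 0ᴹ to 0ᵗ)
    open LeftModuleMorphisms 𝔥.rawLeftModule Tensors.rawLeftModule using (module IsLeftModuleMonomorphism)
    open IsLeftModuleMonomorphism weak.isInjectiveLinear using (⟦⟧-cong; +ᴹ-homo; *ₗ-homo)

    planes : ∀ j → Plane (V j)
    planes j = plane (dims j)
    private module P j = Plane (planes j)
    open Families V planes 𝔥

    T : Family
    T w = record
      { apply    = λ z → multilinear V (φ z) w
      ; isLinear = linear 𝔥 leftModule (λ z → multilinear V (φ z) w)
          (λ y≈z → multilinear-cong V (⟦⟧-cong y≈z) w)
          (λ y z → multilinear-cong V (+ᴹ-homo y z) w)
          (λ c z → multilinear-cong V (*ₗ-homo c z) w)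
      }

    N : Subspace 𝔥
    N = kernel T

    T-cong : Congruent T
    T-cong w≈w′ z = multilinear-argument-cong V (φ z) w≈w′

    T-linear : ∀ j → LinearAt T j
    T-linear j = record
      { additive    = λ w u v z → multilinear-additive V (φ z) w j u v
      ; homogeneous = λ w c v z → multilinear-homogeneous V (φ z) w j c v
      }

    kernel⇒0 : ∀ {z} → Member N z → φ z ≈ᵗ 0ᵗ
    kernel⇒0 {z} z∈N = multilinear-injective V planes (φ z) z∈N

    Σ⁰⇒kernel : ∀ {j ℓ v z t} → φ z ≈ᵗ t → Member (Σ⁰ V j ℓ) t → Member (line ℓ) v →
                Member (kernel (plug T j v)) z
    Σ⁰⇒kernel {j} {ℓ} φz≈t t∈Σ⁰ v∈ℓ w =
      trans (multilinear-cong V φz≈t _) (multilinear-Σ⁰ V j ℓ t∈Σ⁰ v∈ℓ w)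

    codim-N : CodimAtMost N (suc (suc m) ℕ.+ 1)
    codim-N = codim≤dim weak.dim-𝔥 N

    -- A preimage of the first basis vector of the intersection is the witness: were it in N, that
    -- vector would be 0, against independence.
    degenerate-at : ∀ {j ℓ v} → dim weak.φ⟨𝔥⟩ ∩ Σ⁰ V j ℓ ≥ 1 → Member (line ℓ) v →
                    DegeneratesAt T j v
    degenerate-at {j} {ℓ} (suc n , _ , b , basis) v∈ℓ with IsBasis.member basis zero
    ... | (z , φz≈b₀) , b₀∈Σ⁰ = z , z∉N , Σ⁰⇒kernel {j} {ℓ} φz≈b₀ b₀∈Σ⁰ v∈ℓ
      where
      δ : Fin (suc n) → Carrier
      δ zero    = 1#
      δ (suc _) = 0#

      z∉N : ¬ Member N z
      z∉N z∈N = 0≉1 (sym (IsBasis.independent basis δ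
        (Tensors.≈ᴹ-trans (lc-head {V* V} δ b λ _ → refl)
          (Tensors.≈ᴹ-trans (Tensors.*ₗ-congˡ (Tensors.≈ᴹ-trans (Tensors.≈ᴹ-sym φz≈b₀) (kernel⇒0 z∈N)))
            (Tensors.*ₗ-zeroʳ 1#))) zero))

    degenerate : ∀ j → Degenerate T j
    degenerate j = degenerate-from (generic⇒basicOpen (weak.generic j))
      where
      degenerate-from : (Σ[ d ∈ ℕ ] Σ[ p ∈ Homogeneous (V j) d ] (∃ λ v → evaluate (V j) p v ≉ 0#) ×
                          (∀ ℓ → BasicOpen p ℓ → dim weak.φ⟨𝔥⟩ ∩ Σ⁰ V j ℓ ≥ 1)) →
                        Degenerate T j
      degenerate-from (d , p , (v , pv≉0) , dim≥1) =
        -- The factor `x₀` makes w nonzero, so that w spans a point of the projective line.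
        degenerate-everywhere {T} T-cong (T-linear j) codim-N (p ⊠ form (P.x₀ j))
          (_ , proj₂ (common-nonzero p (form (P.x₀ j)) v (P.b₀ j) pv≉0 (P.x₀b₀≉0 j)))
          λ w ≉0 →
            let w≉0 = λ w≈0 → ≉0 (trans (*-congˡ (P.x₀-zero j w≈0)) (zeroʳ _))
                ℓ   = point {V j} w w≉0
                w∈ℓ = ∈point {V j} w w≉0
            in degenerate-at {ℓ = ℓ}
                 (dim≥1 ℓ (w , w∈ℓ , λ ≈0 → ≉0 (trans (*-congʳ ≈0) (zeroˡ _)))) w∈ℓ

    -- There are m + 2 slots here and the rank is at most m + 3. Two independent elements of the
    -- intersection bring it down to m + 1 after plugging v, too small for degeneracy at the m + 1
    -- other slots.
    dim-at-most-1 : ∀ {j ℓ v} is → All (LinearAt (plug T j v)) is → Unique is → length is ≡ suc m →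
      All (Degenerate (plug T j v)) is → Member (line ℓ) v →
      ∀ {n} → ¬ dim weak.φ⟨𝔥⟩ ∩ Σ⁰ V j ℓ ≡ suc (suc n)
    dim-at-most-1 {j} {ℓ} {v} (i ∷ is) linear unique length≡ degenerate-is v∈ℓ {n} (b , basis)
      with IsBasis.member basis zero | IsBasis.member basis (suc zero)
    ... | (y , φy≈b₀) , b₀∈Σ⁰ | (z , φz≈b₁) , b₁∈Σ⁰ =
      codim-lower-bound (plug-congruent {T} T-cong j v) i is unique linear degenerate-is
        (≡.subst (CodimAtMost (kernel (plug T j v))) (≡.trans (ℕₚ.+-comm m 1) (≡.sym length≡))
          (codim-drop₂ N (kernel (plug T j v)) (λ z∈N w → z∈N (update w j v))
            (Σ⁰⇒kernel {j} {ℓ} φy≈b₀ b₀∈Σ⁰ v∈ℓ) (Σ⁰⇒kernel {j} {ℓ} φz≈b₁ b₁∈Σ⁰ v∈ℓ) independent codim-N))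
      where
      independent : ∀ a c → Member N (a 𝔥.*ₗ y 𝔥.+ᴹ c 𝔥.*ₗ z) → a ≈ 0# × c ≈ 0#
      independent a c ay+cz∈N = coefficients≈0 zero , coefficients≈0 (suc zero)
        where
        e : Fin (suc (suc n)) → Carrier
        -- Padding by 0 reduces the independence of `y` and `z` to that of the whole basis, however
        -- long it is.
        e zero          = a
        e (suc zero)    = c
        e (suc (suc _)) = 0#

        open SetoidReasoning Tensors.≈ᴹ-setoid

        coefficients≈0 : ∀ i → e i ≈ 0#
        coefficients≈0 = IsBasis.independent basis e (begin
          linearCombination (V* V) e b
            ≈⟨ Tensors.+ᴹ-congˡ (lc-head {V* V} (e ∘ suc) (b ∘ suc) λ _ → refl) ⟩
          (a *ᵗ b zero) +ᵗ (c *ᵗ b (suc zero))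
            ≈⟨ Tensors.+ᴹ-cong (Tensors.*ₗ-congˡ φy≈b₀) (Tensors.*ₗ-congˡ φz≈b₁) ⟨
          (a *ᵗ φ y) +ᵗ (c *ᵗ φ z)
            ≈⟨ Tensors.+ᴹ-cong (*ₗ-homo a y) (*ₗ-homo c z) ⟨
          φ (a 𝔥.*ₗ y) +ᵗ φ (c 𝔥.*ₗ z)
            ≈⟨ +ᴹ-homo _ _ ⟨
          φ (a 𝔥.*ₗ y 𝔥.+ᴹ c 𝔥.*ₗ z)
            ≈⟨ kernel⇒0 ay+cz∈N ⟩
          0ᵗ ∎)

    others : Fin (suc (suc m)) → List (Fin (suc (suc m)))
    others j = map (Fin.punchIn j) (allFin (suc m))

    linear-at-others : ∀ j v → All (LinearAt (plug T j v)) (others j)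
    linear-at-others j v = Allₚ.map⁺ (All.universal
      (λ i → plug-linear {T} T-cong (Finₚ.punchInᵢ≢i j i) v (T-linear _)) (allFin (suc m)))

    -- The open set is given by a product p q: p ≠ 0 ensures dimension at least 1, and q ≠ 0 keeps
    -- the other slots degenerate, which excludes dimension 2 or more.
    generic : ∀ j → ForGeneric (V j) λ ℓ → dim weak.φ⟨𝔥⟩ ∩ Σ⁰ V j ℓ ≡ 1
    generic j = combine (generic⇒basicOpen (weak.generic j))
      (all-degenerate-generic {T} {j} T-cong (T-linear j) codim-N (others j)
        (Allₚ.map⁺ (All.universal (λ i → Finₚ.punchInᵢ≢i j i ∘ ≡.sym) (allFin (suc m))))
        (All.universal T-linear (others j)) (All.universal degenerate (others j)))
      where
      dim≡1 : ∀ {ℓ v} → All (Degenerate (plug T j v)) (others j) →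
              Member (line ℓ) v → dim weak.φ⟨𝔥⟩ ∩ Σ⁰ V j ℓ ≥ 1 → dim weak.φ⟨𝔥⟩ ∩ Σ⁰ V j ℓ ≡ 1
      dim≡1         _             _   (suc zero    , _ , dim≡1) = dim≡1
      dim≡1 {ℓ} {v} degenerate-js v∈ℓ (suc (suc n) , _ , dim≥2) = contradiction dim≥2
        (dim-at-most-1 {j} {ℓ} {v} (others j) (linear-at-others j v)
          (map⁺ (Finₚ.punchIn-injective j _ _) (allFin⁺ (suc m)))
          (≡.trans (length-map (Fin.punchIn j) (allFin (suc m))) (length-tabulate id))
          degenerate-js v∈ℓ)

      combine : (Σ[ d ∈ ℕ ] Σ[ p ∈ Homogeneous (V j) d ] (∃ λ v → evaluate (V j) p v ≉ 0#) ×
                  (∀ ℓ → BasicOpen p ℓ → dim weak.φ⟨𝔥⟩ ∩ Σ⁰ V j ℓ ≥ 1)) →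
                (Σ[ e ∈ ℕ ] Σ[ q ∈ Homogeneous (V j) e ] (∃ λ v → evaluate (V j) q v ≉ 0#) ×
                  (∀ v → evaluate (V j) q v ≉ 0# → ¬ V._≈ᴹ_ j v (V.0ᴹ j) ×
                    All (Degenerate (plug T j v)) (others j))) →
                ForGeneric (V j) λ ℓ → dim weak.φ⟨𝔥⟩ ∩ Σ⁰ V j ℓ ≡ 1
      combine (d , p , (u , pu≉0) , dim≥1) (e , q , (v , qv≉0) , good) =
        basicOpen⇒generic {P = λ ℓ → dim weak.φ⟨𝔥⟩ ∩ Σ⁰ V j ℓ ≡ 1} (p ⊠ q) w
          (proj₁ (good w (factor₂ w pqw≉0))) pqw≉0
          λ ℓ (w , w∈ℓ , pqw≉0) → dim≡1 {ℓ} {w}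
            (proj₂ (good w (factor₂ w pqw≉0))) w∈ℓ (dim≥1 ℓ (w , w∈ℓ , factor₁ w pqw≉0))
        where
        w : V.Carrierᴹ j
        w = V._+ᴹ_ j u (V._*ₗ_ j (proj₁ (common-nonzero p q u v pu≉0 qv≉0)) (V._+ᴹ_ j v (V.-ᴹ_ j u)))

        pqw≉0 : evaluate (V j) (p ⊠ q) w ≉ 0#
        pqw≉0 = proj₂ (common-nonzero p q u v pu≉0 qv≉0)

        factor₁ : ∀ w → evaluate (V j) (p ⊠ q) w ≉ 0# → evaluate (V j) p w ≉ 0#
        factor₁ w ≉0 ≈0 = ≉0 (trans (*-congʳ ≈0) (zeroˡ _))

        factor₂ : ∀ w → evaluate (V j) (p ⊠ q) w ≉ 0# → evaluate (V j) q w ≉ 0#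
        factor₂ w ≉0 ≈0 = ≉0 (trans (*-congˡ ≈0) (zeroʳ _))

    factorization : IsFactorizationStructure V 𝔥 φ
    factorization = record
      { isInjectiveLinear = weak.isInjectiveLinear
      ; dim-𝔥             = weak.dim-𝔥
      ; generic           = generic
      }

-- The real and complex numbers as infinite fields

module Ordered (em : ExcludedMiddle 0ℓ) (ℝ : CompleteOrderedField) where
  open CompleteOrderedField ℝ hiding (zero) renaming (_≤_ to infix 4 _≤ʳ_)
  open IntegerCoefficients commutativeRing
  private module ≤ʳ = IsTotalOrder isTotalOrder

  neg-nonNeg : ∀ {x} → x ≤ʳ 0# → 0# ≤ʳ - x
  neg-nonNeg {x} x≤0 = ≤ʳ.≤-respˡ-≈ (-‿inverseʳ x) (≤ʳ.≤-respʳ-≈ (+-identityˡ (- x)) (+-mono-≤ (- x) x≤0))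

  square-nonNeg : ∀ x → 0# ≤ʳ x * x
  square-nonNeg x with ≤ʳ.total 0# x
  ... | inj₁ 0≤x = *-nonNeg 0≤x 0≤x
  ... | inj₂ x≤0 = ≤ʳ.≤-respʳ-≈ (solve 1 (λ x → :- x :* :- x := x :* x) refl x)
                     (*-nonNeg (neg-nonNeg x≤0) (neg-nonNeg x≤0))

  0≤1 : 0# ≤ʳ 1#
  0≤1 = ≤ʳ.≤-respʳ-≈ (*-identityˡ 1#) (square-nonNeg 1#)

  ≤-+ : ∀ {y} x → 0# ≤ʳ y → x ≤ʳ x + y
  ≤-+ {y} x 0≤y = ≤ʳ.≤-respˡ-≈ (+-identityˡ x) (≤ʳ.≤-respʳ-≈ (+-comm y x) (+-mono-≤ x 0≤y))

  fromℕ : ℕ → Carrier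
  fromℕ zero    = 0#
  fromℕ (suc n) = fromℕ n + 1#

  fromℕ-mono : ∀ {m n} → m ≤′ n → fromℕ m ≤ʳ fromℕ n
  fromℕ-mono ≤′-refl        = ≤ʳ.refl
  fromℕ-mono (≤′-step m≤′n) = ≤ʳ.trans (fromℕ-mono m≤′n) (≤-+ _ 0≤1)

  -- Otherwise m + 1 ≤ n = m in the field, and subtracting m gives 1 ≤ 0.
  fromℕ-<-≉ : ∀ {m n} → m ℕ.< n → fromℕ m ≉ fromℕ n
  fromℕ-<-≉ {m} m<n m≈n = 0≉1 (≤ʳ.antisym 0≤1
    (≤ʳ.≤-respʳ-≈ (-‿inverseʳ (fromℕ m)) (≤ʳ.≤-respˡ-≈
      (solve 2 (λ x y → (x :+ y) :- x := y) refl (fromℕ m) 1#)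
      (+-mono-≤ (- fromℕ m) (≤ʳ.≤-respʳ-≈ (sym m≈n) (fromℕ-mono (ℕₚ.≤⇒≤′ m<n)))))))

  fromℕ-injective : ∀ {m n} → fromℕ m ≈ fromℕ n → m ≡ n
  fromℕ-injective {m} {n} m≈n with ℕₚ.<-cmp m n
  ... | tri< m<n _ _ = contradiction m≈n (fromℕ-<-≉ m<n)
  ... | tri≈ _ m≡n _ = m≡n
  ... | tri> _ _ n<m = contradiction (sym m≈n) (fromℕ-<-≉ n<m)

  realField : InfiniteField
  realField = record
    { commutativeRing = commutativeRing
    ; 0≉1             = 0≉1
    ; inverse         = inverse
    ; ι               = fromℕ
    ; ι-injective     = fromℕ-injective
    }

  open OverInfiniteField em realField using (dne; *-nonzero)
  private module ℂ = CommutativeRing (Complex.complexRing ℝ)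

  sum-of-squares-0 : ∀ a b → a * a + b * b ≈ 0# → a ≈ 0#
  sum-of-squares-0 a b a²+b²≈0 = dne λ a≉0 → *-nonzero a≉0 a≉0
    (≤ʳ.antisym (≤ʳ.≤-respʳ-≈ a²+b²≈0 (≤-+ (a * a) (square-nonNeg b))) (square-nonNeg a))

  complex-inverse : ∀ x → ¬ x ℂ.≈ ℂ.0# → ∃ λ y → x ℂ.* y ℂ.≈ ℂ.1#
  complex-inverse (a , b) ab≉0
    with inverse (a * a + b * b) (λ ≈0 → ab≉0
           (sum-of-squares-0 a b ≈0 , sum-of-squares-0 b a (trans (+-comm _ _) ≈0)))
  -- The conjugate a - b i divided by a² + b².
  ... | r , nr≈1 = (a * r , - (b * r)) ,
    trans (solve 3 (λ a b r → a :* (a :* r) :- b :* :- (b :* r) := (a :* a :+ b :* b) :* r)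
      refl a b r) nr≈1 ,
    solve 3 (λ a b r → a :* :- (b :* r) :+ b :* (a :* r) := con (+ 0)) refl a b r

  complexField : InfiniteField
  complexField = record
    { commutativeRing = Complex.complexRing ℝ
    ; 0≉1             = 0≉1 ∘ proj₁
    ; inverse         = complex-inverse
    ; ι               = λ n → fromℕ n , 0#
    ; ι-injective     = fromℕ-injective ∘ proj₁
    }

theorem2p21 : ExcludedMiddle 0ℓ →
    (ℝ : CompleteOrderedField) (𝔽 : ScalarField) →
    (let open Linear (scalars ℝ 𝔽)) →
    (m : ℕ) → 2 ≤ m →
    (V : Fin m → VectorSpace) → (∀ j → dim whole (V j) ≡ 2) →
    (𝔥 : VectorSpace) (φ : LeftModule.Carrierᴹ 𝔥 → LeftModule.Carrierᴹ (V* V)) →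
    IsWeakFactorizationStructure V 𝔥 φ → IsFactorizationStructure V 𝔥 φ
theorem2p21 em ℝ real    (suc (suc m)) (s≤s (s≤s z≤n)) =
  OverInfiniteField.factorization em (Ordered.realField em ℝ)
theorem2p21 em ℝ complex (suc (suc m)) (s≤s (s≤s z≤n)) =
  OverInfiniteField.factorization em (Ordered.complexField em ℝ)
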